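{- The optimization problem Min Distance-Edge-Monitoring Set is approximable within a factor of $\ln(|E(G)|+1)$ in polynomial time, where $G$ is the input graph (a finite simple connected graph).
   Context: $d_G(x,y)$ denotes the distance between vertices $x,y$ in $G$ (equal to $\infty$ if $x$ and $y$ are in different components), and $G-e$ is the graph obtained from $G$ by deleting the edge $e$. An edge $e$ of $G$ is monitored by a vertex $x$ if there is a vertex $y$ of $G$ with $d_G(x,y)\neq d_{G-e}(x,y)$ (equivalently, $e$ belongs to all shortest paths between $x$ and $y$ in $G$). A set $M\subseteq V(G)$ is distance-edge-monitoring if every edge of $G$ is monitored by some vertex of $M$. Min Distance-Edge-Monitoring Set is the problem: given a graph $G$, build a smallest possible distance-edge-monitoring set of $G$. A $c$-approximation algorithm for an optimization problem is an algorithm that returns a solution whose size is always at most $c$ times the optimum; the problem is approximable within a factor of $c$ in polynomial time if it has such an algorithm running in polynomial time. $E(G)$ is the edge set of $G$, and $\ln$ is the natural logarithm.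
   Formalization: The factor is read as max(1, ln(|E(G)|+1)), because for the graph with two vertices and one edge the optimum is 1 while ln 2 < 1, so the literal claim fails there; for every other connected graph the two bounds agree. -}

module Defs where

open import Data.Bool.Base using (Bool; true; false; T; not; _∧_; _∨_; if_then_else_)
open import Data.Bool.Properties using (∨-comm)
open import Data.Fin.Base using (Fin; toℕ; fromℕ<; remQuot)
open import Data.Fin.Properties using (_≟_; _<?_)
open import Data.Fin.Subset using (Subset; _∈_; ∣_∣)
open import Data.Integer.Base using (+_)
open import Data.List.Base using (List; length; allFin; cartesianProduct; filterᵇ)
open import Data.Nat.Base using (ℕ; zero; suc; _+_; _*_; _∸_; _^_; _≤_; _<_; _≡ᵇ_)
import Data.Nat.Properties as ℕ
open import Data.Product.Base using (Σ; ∃; ∃-syntax; _×_; _,_; uncurry)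
open import Data.Rational.Base as ℚ using (ℚ; 0ℚ; 1ℚ)
open import Data.Sum.Base using (_⊎_)
open import Data.Vec.Base using (tabulate)
open import Relation.Binary.PropositionalEquality using (_≡_; _≢_; refl; cong; cong₂)
open import Relation.Nullary.Construct.Add.Supremum using (_⁺; ⊤⁺; [_])
open import Relation.Nullary.Decidable.Core using (⌊_⌋; yes; no)
open import Relation.Nullary.Negation.Core using (¬_)

------------------------------------------------------------------------
-- Finite simple graphs

record Graph : Set where
  field
    order      : ℕ
    adj        : Fin order → Fin order → Bool
    adj-sym    : ∀ u v → adj u v ≡ adj v u
    adj-irrefl : ∀ u → adj u u ≡ false

  Vertex : Set
  Vertex = Fin order

  Adj : Vertex → Vertex → Set
  Adj u v = T (adj u v)

  -- Each edge is listed once, with its smaller endpoint first.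
  edges : List (Vertex × Vertex)
  edges = filterᵇ (λ (u , v) → ⌊ u <? v ⌋ ∧ adj u v)
                  (cartesianProduct (allFin order) (allFin order))

open Graph public

∣E_∣ : Graph → ℕ
∣E G ∣ = length (edges G)

-- u and v are a and b, in either order
sameEdge : ∀ {n} → Fin n → Fin n → Fin n → Fin n → Bool
sameEdge a b u v = (⌊ u ≟ a ⌋ ∧ ⌊ v ≟ b ⌋) ∨ (⌊ v ≟ a ⌋ ∧ ⌊ u ≟ b ⌋)

deleteEdge : (G : Graph) → Vertex G → Vertex G → Graph
deleteEdge G a b = record
  { order      = order G
  ; adj        = λ u v → adj G u v ∧ not (sameEdge a b u v)
  ; adj-sym    = λ u v → cong₂ (λ p q → p ∧ not q) (adj-sym G u v)
                   (∨-comm (⌊ u ≟ a ⌋ ∧ ⌊ v ≟ b ⌋) (⌊ v ≟ a ⌋ ∧ ⌊ u ≟ b ⌋))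
  ; adj-irrefl = λ u → cong (_∧ not (sameEdge a b u u)) (adj-irrefl G u)
  }

data Walk (G : Graph) : Vertex G → Vertex G → ℕ → Set where
  nil  : ∀ {x} → Walk G x x 0
  cons : ∀ {x y z k} → Adj G x y → Walk G y z k → Walk G x z (suc k)

Connected : Graph → Set
Connected G = 0 < order G × (∀ (x y : Vertex G) → ∃[ k ] Walk G x y k)

-- IsDistance G x y d says d_G(x,y) = d, where ⊤⁺ is ∞.
IsDistance : (G : Graph) → Vertex G → Vertex G → ℕ ⁺ → Set
IsDistance G x y [ k ] = Walk G x y k × (∀ j → Walk G x y j → k ≤ j)
IsDistance G x y ⊤⁺    = ∀ j → ¬ Walk G x y j

-- The vertex x monitors the edge ab.
Monitors : (G : Graph) → Vertex G → Vertex G → Vertex G → Set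
Monitors G x a b =
  Σ (Vertex G) λ y → ∃[ d ] ∃[ d′ ]
    IsDistance G x y d × IsDistance (deleteEdge G a b) x y d′ × d ≢ d′

DistanceEdgeMonitoring : (G : Graph) → Subset (order G) → Set
DistanceEdgeMonitoring G M =
  ∀ a b → Adj G a b → ∃[ x ] x ∈ M × Monitors G x a b

------------------------------------------------------------------------
-- Real factors

-- A real c is represented by its closed lower cut: C q means q ≤ c.
Cut : Set₁
Cut = ℚ → Set

fromℕ : ℕ → ℚ
fromℕ n = + n ℚ./ 1

-- q^k / k!
expTerm : ℚ → ℕ → ℚ
expTerm q zero    = 1ℚ
expTerm q (suc k) = expTerm q k ℚ.* q ℚ.* (+ 1 ℚ./ suc k)

-- Sum of the first k terms of the series of exp q
expSum : ℚ → ℕ → ℚ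
expSum q zero    = 0ℚ
expSum q (suc k) = expSum q k ℚ.+ expTerm q k

-- For x ≥ 1: q ≤ ln x iff exp (max 0 q) ≤ x.  At a nonnegative argument the
-- partial sums increase to the exponential, so it is enough to bound them all.
ln : ℕ → Cut
ln x q = ∀ k → expSum (0ℚ ℚ.⊔ q) k ℚ.≤ fromℕ x

-- max 1 c: no algorithm beats an optimum that is positive, so a factor
-- below 1 is read as 1.  For a connected graph with m edges the factor
-- ln (m + 1) exceeds 1 if m ≥ 2, and the optimum is 0 if m = 0; the maximum
-- matters only for K₂, where the optimum is 1 and ln 2 < 1.
max1 : Cut → Cut
max1 C q = q ℚ.≤ 1ℚ ⊎ C q

-- a ≤ c · b.  If b > 0 this says a / b ≤ c, and if b = 0 it says a = 0.
_≤_·_ : ℕ → Cut → ℕ → Set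
a ≤ C · b = ∃[ q ] C q × fromℕ a ℚ.≤ q ℚ.* fromℕ b

------------------------------------------------------------------------
-- Model of computation: a random access machine with indirect addressing,
-- addition and truncated subtraction at unit cost.  There is no
-- multiplication, so the bit length of stored numbers grows by at most a
-- constant per step, and polynomial time here agrees with polynomial time
-- on Turing machines.

data Expr : Set where
  lit     : ℕ → Expr
  var     : ℕ → Expr
  load    : ℕ → Expr → Expr
  _⊕_ _⊖_ : Expr → Expr → Expr

data Program : Set where
  skip          : Program
  _≔_           : ℕ → Expr → Program
  store         : ℕ → Expr → Expr → Program
  _⨾_           : Program → Program → Program
  ifte          : Expr → Program → Program → Program
  while         : Expr → Program → Program

-- A program mentions only finitely many variables and arrays.
record State : Set where
  constructor ⟨_,_⟩
  field
    vars : ℕ → ℕ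
    arrs : ℕ → ℕ → ℕ

open State public

update : {A : Set} → ℕ → A → (ℕ → A) → ℕ → A
update i a f j = if j ≡ᵇ i then a else f j

⟦_⟧ : Expr → State → ℕ
⟦ lit n ⟧    s = n
⟦ var x ⟧    s = vars s x
⟦ load a e ⟧ s = arrs s a (⟦ e ⟧ s)
⟦ e ⊕ f ⟧    s = ⟦ e ⟧ s + ⟦ f ⟧ s
⟦ e ⊖ f ⟧    s = ⟦ e ⟧ s ∸ ⟦ f ⟧ s

setVar : ℕ → ℕ → State → State
setVar x n s = ⟨ update x n (vars s) , arrs s ⟩

setCell : ℕ → ℕ → ℕ → State → State
setCell a i n s = ⟨ vars s , update a (update i n (arrs s a)) (arrs s) ⟩

-- Run p s t s′: started in s, the program p halts in s′ after t steps.  A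
-- step includes evaluating an expression, whose size depends on p alone.
data Run : Program → State → ℕ → State → Set where
  skip        : ∀ {s} → Run skip s 1 s
  assign      : ∀ {s x e} → Run (x ≔ e) s 1 (setVar x (⟦ e ⟧ s) s)
  store       : ∀ {s a e f} →
                Run (store a e f) s 1 (setCell a (⟦ e ⟧ s) (⟦ f ⟧ s) s)
  seq         : ∀ {p q s s′ s″ t t′} →
                Run p s t s′ → Run q s′ t′ s″ → Run (p ⨾ q) s (t + t′) s″
  if-true     : ∀ {e p q s s′ t} → ⟦ e ⟧ s ≢ 0 →
                Run p s t s′ → Run (ifte e p q) s (suc t) s′
  if-false    : ∀ {e p q s s′ t} → ⟦ e ⟧ s ≡ 0 →
                Run q s t s′ → Run (ifte e p q) s (suc t) s′
  while-true  : ∀ {e p s s′ s″ t t′} → ⟦ e ⟧ s ≢ 0 →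
                Run p s t s′ → Run (while e p) s′ t′ s″ →
                Run (while e p) s (suc (t + t′)) s″
  while-false : ∀ {e p s} → ⟦ e ⟧ s ≡ 0 → Run (while e p) s 1 s

------------------------------------------------------------------------
-- Minimisation problems and approximation algorithms

record MinProblem : Set₁ where
  field
    Instance : Set
    size     : Instance → ℕ
    Solution : Instance → Set
    Feasible : (I : Instance) → Solution I → Set
    cost     : (I : Instance) → Solution I → ℕ
    encode   : Instance → State
    decode   : (I : Instance) → State → Solution I

  Optimal : (I : Instance) → Solution I → Set
  Optimal I S = Feasible I S × (∀ S′ → Feasible I S′ → cost I S ≤ cost I S′)

  -- Execution is deterministic, so the run asserted to exist is the only one.
  ApproximableInPolyTime : (Instance → Cut) → Set
  ApproximableInPolyTime factor =
    ∃[ p ] ∃[ k ] ∀ (I : Instance) → ∃[ t ] ∃[ s ]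
      Run p (encode I) t s
      × t ≤ k * size I ^ k + k
      × Feasible I (decode I s)
      × (∀ S → Optimal I S → cost I (decode I s) ≤ factor I · cost I S)

open MinProblem public using (ApproximableInPolyTime)

-- Variable 0 holds the order n, and cell i * n + j of array 0 holds 1 or 0
-- according to whether i and j are adjacent; all else is 0.
encodeGraph : Graph → State
encodeGraph G = ⟨ update 0 n (λ _ → 0) , update 0 matrix (λ _ _ → 0) ⟩
  where
  n = order G

  matrix : ℕ → ℕ
  matrix c with c ℕ.<? n * n
  ... | yes c<n² = if uncurry (adj G) (remQuot n (fromℕ< c<n²)) then 1 else 0
  ... | no  _    = 0

-- The vertices i whose cell i of array 1 is nonzero
decodeSubset : ∀ n → State → Subset n
decodeSubset n s = tabulate (λ i → not (arrs s 1 (toℕ i) ≡ᵇ 0))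

MinDistanceEdgeMonitoringSet : MinProblem
MinDistanceEdgeMonitoringSet = record
  { Instance = Σ Graph Connected
  ; size     = λ (G , _) → suc (order G * order G)
  ; Solution = λ (G , _) → Subset (order G)
  ; Feasible = λ (G , _) → DistanceEdgeMonitoring G
  ; cost     = λ _ → ∣_∣
  ; encode   = λ (G , _) → encodeGraph G
  ; decode   = λ (G , _) → decodeSubset (order G)
  }

{-# OPTIONS --safe #-}
module Submission where

open import Data.Bool.Base using (Bool; true; false; T; not; _∧_; if_then_else_)
open import Data.Bool.Properties using (T?; T-∧; ∨-comm)
open import Data.Empty using (⊥)
open import Data.Fin.Base using (Fin; zero; suc; toℕ; fromℕ<; combine; remQuot)
open import Data.Fin.Properties
  using (_≟_; _<?_; <-cmp; any?; pigeonhole; toℕ-injective; toℕ<n; toℕ-fromℕ<; toℕ-combine; remQuot-combine)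
open import Data.Fin.Subset using (Subset; _∈_; ∣_∣)
open import Data.Integer.Base as ℤ using ()
import Data.Integer.Properties as ℤ
open import Data.List.Base as List using ([]; _∷_; length; filterᵇ; _++_; cartesianProduct; allFin; map)
open import Data.Nat.Base
  using (ℕ; zero; suc; _+_; _*_; _∸_; _^_; _≤_; _<_; _≡ᵇ_; z≤n; s≤s)
open import Data.Nat.Induction using (<-rec)
import Data.Nat.Properties as ℕ
open import Data.Nat.Solver using () renaming (module +-*-Solver to ℕ-Solver)
open import Data.Product.Base using (∃-syntax; _×_; _,_; proj₁; proj₂; uncurry)
open import Data.Rational.Base as ℚ using (ℚ; 0ℚ; 1ℚ; ½; toℚᵘ)
import Data.Rational.Properties as ℚ
open import Data.Rational.Solver using () renaming (module +-*-Solver to ℚ-Solver)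
open import Data.Rational.Unnormalised.Base as ℚᵘ using (mkℚᵘ; *≡*)
import Data.Rational.Unnormalised.Properties as ℚᵘ
open import Data.Sum.Base using (_⊎_; inj₁; inj₂)
open import Data.Vec.Base using (Vec; []; _∷_; lookup)
open import Data.Vec.Properties using (lookup∘tabulate; []=⇒lookup; lookup⇒[]=)
open import Function.Base using (id; _∘_)
open import Function.Bundles using (Equivalence)
open import Relation.Binary.Definitions using (tri<; tri≈; tri>)
open import Relation.Binary.PropositionalEquality
open import Relation.Nullary using (¬_; Dec; yes; no; contradiction)
open import Relation.Nullary.Construct.Add.Supremum using (⊤⁺; [_])
open import Relation.Nullary.Decidable using (_×-dec_; ¬?; ⌊_⌋; decidable-stable)
open import Algebra.Properties.CommutativeMonoid.Sum ℕ.+-0-commutativeMonoid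
  using (sum; sum-cong-≗; ∑-comm; ∑-distrib-+)
open import Defs

-- A vertex x monitors an edge iff all shortest walks from x to one endpoint b
-- arrive through the other endpoint, which depends only on the existence of
-- walks of each length up to n.  The problem is thus a set cover problem, for
-- which the greedy algorithm runs in polynomial time.  If K vertices suffice,
-- a greedy choice newly covers at least a 1 / K fraction of the u uncovered
-- edges, and as long as u > K it covers at least two.  Then u + 1 shrinks by a
-- factor of at least (2K + 1) / (2K - 1) ≥ exp (1 / K), and when u ≤ K at most
-- u more choices are made; for K ≥ 2 this gives exp (N / K) ≤ m + 1 for the
-- number N of choices.  The exponential is handled through its partial sums,
-- which satisfy (2 - h) exp (x + h) ≤ (2 + h) exp x by the trapezoidal rule.

-- A language of bounded loops and its compilation

-- The usual analysis of greedy set cover loses an additive constant at the end, when few elements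
-- are left. Comparing exp (N / K) with u + 1 instead of u absorbs this loss, but not step by step:
-- a choice with c = 1 at u = K shrinks u + 1 only by (K + 1) / K < exp (1 / K). By the greedy bound
-- u ≤ cK such a choice occurs only when u ≤ K, and from there on all N ≤ u remaining choices are
-- treated as one step of width N / K. The trapezoidal rule then gives exp (N / K) ≤ (2K + N) / (2K
-- - N), and this is at most N + 1 because N ≤ K and K ≥ 2. For K = 1 the first choice covers
-- everything. On the machine side every loop of the source language runs exactly n times.
-- Evaluation is therefore a total function, the number of steps depends on n alone, and the time
-- bound is an induction on syntax. The price is that the greedy search cannot stop early: it makes
-- n² passes, and those made after everything is covered must leave the chosen set unchanged.

Arrays : Set
Arrays = ℕ → ℕ → ℕ

if≢0 : {A : Set} → ℕ → A → A → A
if≢0 zero    x y = y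
if≢0 (suc _) x y = x

data Term (d : ℕ) : Set where
  num     : ℕ → Term d
  at      : Fin d → Term d
  get     : ℕ → Term d → Term d
  _⊞_ _⊟_ : Term d → Term d → Term d
  cond    : Term d → Term d → Term d → Term d
  bind    : Term d → Term (suc d) → Term d
  ∑       : Term (suc d) → Term d

data Command (d : ℕ) : Set where
  put   : ℕ → Term d → Term d → Command d
  _﹔_  : Command d → Command d → Command d
  loop  : Command (suc d) → Command d

eval : ∀ {d} → ℕ → Arrays → Vec ℕ d → Term d → ℕ
eval n A e (num c)      = c
eval n A e (at i)       = lookup e i
eval n A e (get a t)    = A a (eval n A e t)
eval n A e (t ⊞ u)      = eval n A e t + eval n A e u
eval n A e (t ⊟ u)      = eval n A e t ∸ eval n A e u
eval n A e (cond c t u) = if≢0 (eval n A e c) (eval n A e t) (eval n A e u)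
eval n A e (bind t u)   = eval n A (eval n A e t ∷ e) u
eval n A e (∑ t)        = sum {n} (λ i → eval n A (toℕ i ∷ e) t)

repeat : {A : Set} → (ℕ → A → A) → ℕ → ℕ → A → A
repeat f i zero    x = x
repeat f i (suc m) x = repeat f (suc i) m (f i x)

setArr : ℕ → ℕ → ℕ → Arrays → Arrays
setArr a i v A = update a (update i v (A a)) A

exec : ∀ {d} → ℕ → Vec ℕ d → Command d → Arrays → Arrays
exec n e (put a t u) A = setArr a (eval n A e t) (eval n A e u) A
exec n e (c ﹔ d)    A = exec n e d (exec n e c A)
exec n e (loop c)    A = repeat (λ i → exec n (i ∷ e) c) 0 n A

-- The value ends up in register `r`, with scratch space only above it; `ρ` lists the registers of
-- the variables. Both branches of `cond` are evaluated before the test, so that the time does not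
-- depend on the data.
compileTerm : ∀ {d} → Term d → Vec ℕ d → ℕ → Program
compileTerm (num c)      ρ r = r ≔ lit c
compileTerm (at i)       ρ r = r ≔ var (lookup ρ i)
compileTerm (get a t)    ρ r = compileTerm t ρ r ⨾ (r ≔ load a (var r))
compileTerm (t ⊞ u)      ρ r =
  compileTerm t ρ r ⨾ (compileTerm u ρ (1 + r) ⨾ (r ≔ (var r ⊕ var (1 + r))))
compileTerm (t ⊟ u)      ρ r =
  compileTerm t ρ r ⨾ (compileTerm u ρ (1 + r) ⨾ (r ≔ (var r ⊖ var (1 + r))))
compileTerm (cond c t u) ρ r =
  compileTerm c ρ r ⨾ (compileTerm t ρ (1 + r) ⨾ (compileTerm u ρ (2 + r) ⨾
    ifte (var r) (r ≔ var (1 + r)) (r ≔ var (2 + r))))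
compileTerm (bind t u)   ρ r =
  compileTerm t ρ r ⨾ (compileTerm u (r ∷ ρ) (1 + r) ⨾ (r ≔ var (1 + r)))
compileTerm (∑ t)        ρ r =
  (r ≔ lit 0) ⨾ (((1 + r) ≔ lit 0) ⨾ while (var 0 ⊖ var (1 + r))
    (compileTerm t (1 + r ∷ ρ) (2 + r) ⨾
      ((r ≔ (var r ⊕ var (2 + r))) ⨾ ((1 + r) ≔ (var (1 + r) ⊕ lit 1)))))

compile : ∀ {d} → Command d → Vec ℕ d → ℕ → Program
compile (put a t u) ρ r =
  compileTerm t ρ r ⨾ (compileTerm u ρ (1 + r) ⨾ store a (var r) (var (1 + r)))
compile (c ﹔ d)    ρ r = compile c ρ r ⨾ compile d ρ r
compile (loop c)    ρ r =
  (r ≔ lit 0) ⨾ while (var 0 ⊖ var r)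
    (compile c (r ∷ ρ) (1 + r) ⨾ (r ≔ (var r ⊕ lit 1)))

loopTime : ℕ → ℕ → ℕ
loopTime t zero    = 1
loopTime t (suc m) = suc (t + loopTime t m)

termTime : ∀ {d} → ℕ → Term d → ℕ
termTime n (num c)      = 1
termTime n (at i)       = 1
termTime n (get a t)    = termTime n t + 1
termTime n (t ⊞ u)      = termTime n t + (termTime n u + 1)
termTime n (t ⊟ u)      = termTime n t + (termTime n u + 1)
termTime n (cond c t u) = termTime n c + (termTime n t + (termTime n u + 2))
termTime n (bind t u)   = termTime n t + (termTime n u + 1)
termTime n (∑ t)        = 1 + (1 + loopTime (termTime n t + (1 + 1)) n)

time : ∀ {d} → ℕ → Command d → ℕ
time n (put a t u) = termTime n t + (termTime n u + 1)
time n (c ﹔ d)    = time n c + time n d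
time n (loop c)    = 1 + loopTime (time n c + 1) n

-- Correctness of the compilation

≡ᵇ-refl : ∀ i → (i ≡ᵇ i) ≡ true
≡ᵇ-refl zero    = refl
≡ᵇ-refl (suc i) = ≡ᵇ-refl i

≢⇒≡ᵇ-false : ∀ i j → i ≢ j → (i ≡ᵇ j) ≡ false
≢⇒≡ᵇ-false zero    zero    i≢j = contradiction refl i≢j
≢⇒≡ᵇ-false zero    (suc j) i≢j = refl
≢⇒≡ᵇ-false (suc i) zero    i≢j = refl
≢⇒≡ᵇ-false (suc i) (suc j) i≢j = ≢⇒≡ᵇ-false i j (λ i≡j → i≢j (cong suc i≡j))

module _ {A : Set} (f : ℕ → A) (v : A) where

  update-same : ∀ i → update i v f i ≡ v
  update-same i rewrite ≡ᵇ-refl i = refl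

  update-other : ∀ {i j} → j ≢ i → update i v f j ≡ f j
  update-other {i} {j} j≢i rewrite ≢⇒≡ᵇ-false j i j≢i = refl

-- The registers below r are in use: register 0 holds n, and those listed in ρ
-- hold the values e of the variables.
record Ready {d : ℕ} (n : ℕ) (A : Arrays) (ρ e : Vec ℕ d) (r : ℕ) (s : State) : Set where
  field
    positive  : 0 < r
    order     : vars s 0 ≡ n
    arrays    : arrs s ≡ A
    allocated : ∀ i → lookup ρ i < r
    variables : ∀ i → vars s (lookup ρ i) ≡ lookup e i

open Ready

record Frame (r : ℕ) (s s′ : State) : Set where
  field
    keeps : ∀ {i} → i < r → vars s′ i ≡ vars s i

open Frame

frame-refl : ∀ {r s} → Frame r s s
frame-refl = record { keeps = λ _ → refl }

frame-trans : ∀ {r r′ s s′ s″} → r ≤ r′ → Frame r s s′ → Frame r′ s′ s″ → Frame r s s″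
frame-trans r≤r′ f g = record
  { keeps = λ i<r → trans (g .keeps (ℕ.<-≤-trans i<r r≤r′)) (f .keeps i<r) }

frame-shrink : ∀ {r r′ s s′} → r ≤ r′ → Frame r′ s s′ → Frame r s s′
frame-shrink r≤r′ f = record { keeps = λ i<r → f .keeps (ℕ.<-≤-trans i<r r≤r′) }

frame-set : ∀ {r x v s} → r ≤ x → Frame r s (setVar x v s)
frame-set {s = s} r≤x = record
  { keeps = λ i<r → update-other (vars s) _ (ℕ.<⇒≢ (ℕ.<-≤-trans i<r r≤x)) }

module _ {d n : ℕ} {ρ e : Vec ℕ d} where

  ready-frame : ∀ {r s s′ A A′} → Ready n A ρ e r s → arrs s′ ≡ A′ → Frame r s s′ →
                Ready n A′ ρ e r s′
  ready-frame R eq f = record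
    { positive  = R .positive
    ; order     = trans (f .keeps (R .positive)) (R .order)
    ; arrays    = eq
    ; allocated = R .allocated
    ; variables = λ i → trans (f .keeps (R .allocated i)) (R .variables i)
    }

  ready-weaken : ∀ {r r′ s A} → r ≤ r′ → Ready n A ρ e r s → Ready n A ρ e r′ s
  ready-weaken r≤r′ R = record
    { positive  = ℕ.<-≤-trans (R .positive) r≤r′
    ; order     = R .order
    ; arrays    = R .arrays
    ; allocated = λ i → ℕ.<-≤-trans (R .allocated i) r≤r′
    ; variables = R .variables
    }

  ready-bind : ∀ {r s A v} → Ready n A ρ e r s → vars s r ≡ v →
               Ready n A (r ∷ ρ) (v ∷ e) (suc r) s
  ready-bind {r} R eq = record
    { positive  = s≤s z≤n
    ; order     = R .order
    ; arrays    = R .arrays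
    ; allocated = λ where
        zero    → ℕ.≤-refl
        (suc i) → ℕ.m≤n⇒m≤1+n (R .allocated i)
    ; variables = λ where
        zero    → eq
        (suc i) → R .variables i
    }

record Computes (p : Program) (s : State) (t : ℕ) (A : Arrays) (r v : ℕ) : Set where
  field
    end    : State
    run    : Run p s t end
    arrs≡  : arrs end ≡ A
    result : vars end r ≡ v
    frame  : Frame r s end

record Executes (p : Program) (s : State) (t : ℕ) (A : Arrays) (r : ℕ) : Set where
  field
    end    : State
    run    : Run p s t end
    arrs≡  : arrs end ≡ A
    frame  : Frame r s end

≤1+ : ∀ {r} → r ≤ 1 + r
≤1+ {r} = ℕ.n≤1+n r

≤2+ : ∀ {r} → r ≤ 2 + r
≤2+ {r} = ℕ.m≤n+m r 2

counter-suc : ∀ {i m n} → i + suc m ≡ n → suc i + m ≡ n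
counter-suc {i} {m} eq = trans (sym (ℕ.+-suc i m)) eq

counter-< : ∀ {i m n} → i + suc m ≡ n → i < n
counter-< {i} {m} eq = subst (i <_) eq (ℕ.m<m+n i (s≤s z≤n))

counter-end : ∀ {i n} → i + 0 ≡ n → n ∸ i ≡ 0
counter-end {i} refl = trans (cong (_∸ i) (ℕ.+-identityʳ i)) (ℕ.n∸n≡0 i)

-- The second operand is computed from register `1 + r` on, so its frame condition preserves the
-- first value in register `r`.
compileBinary-correct : ∀ {d n A r s} {ρ e : Vec ℕ d} (t u : Term d) (_∙_ : ℕ → ℕ → ℕ)
         {x : Expr} → (∀ s′ → ⟦ x ⟧ s′ ≡ vars s′ r ∙ vars s′ (1 + r)) →
         Ready n A ρ e r s →
         (∀ {r s} → Ready n A ρ e r s →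
           Computes (compileTerm t ρ r) s (termTime n t) A r (eval n A e t)) →
         (∀ {r s} → Ready n A ρ e r s →
           Computes (compileTerm u ρ r) s (termTime n u) A r (eval n A e u)) →
         Computes (compileTerm t ρ r ⨾ (compileTerm u ρ (1 + r) ⨾ (r ≔ x)))
                  s (termTime n t + (termTime n u + 1)) A r (eval n A e t ∙ eval n A e u)
compileBinary-correct {r = r} {s} t u _∙_ {x} eq R ht hu = record
  { run    = seq (Computes.run V) (seq (Computes.run U) assign)
  ; arrs≡  = Computes.arrs≡ U
  ; result = trans (update-same (vars s₂) _ r) (trans (eq s₂)
      (cong₂ _∙_ (trans (Computes.frame U .keeps ℕ.≤-refl) (Computes.result V)) (Computes.result U)))
  ; frame  = frame-trans ℕ.≤-refl
               (frame-trans ≤1+ (Computes.frame V) (Computes.frame U))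
               (frame-set ℕ.≤-refl)
  }
  where
  V  = ht R
  s₁ = Computes.end V
  R₁ = ready-weaken ≤1+ (ready-frame R (Computes.arrs≡ V) (Computes.frame V))
  U  = hu R₁
  s₂ = Computes.end U

compileTerm-correct : ∀ {d n A} {ρ e : Vec ℕ d} (t : Term d) → ∀ {r s} → Ready n A ρ e r s →
                      Computes (compileTerm t ρ r) s (termTime n t) A r (eval n A e t)
compileTerm-correct (num c) {r} {s} R = record
  { run = assign ; arrs≡ = R .arrays ; result = update-same (vars s) c r
  ; frame = frame-set ℕ.≤-refl }
compileTerm-correct (at i) {r} {s} R = record
  { run = assign ; arrs≡ = R .arrays
  ; result = trans (update-same (vars s) _ r) (R .variables i)
  ; frame = frame-set ℕ.≤-refl }
compileTerm-correct {n = n} {A} {e = e} (get a t) {r} {s} R = record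
  { run = seq (Computes.run V) assign ; arrs≡ = Computes.arrs≡ V
  ; result = trans (update-same (vars s₁) _ r)
      (cong₂ (λ B → B a) (Computes.arrs≡ V) (Computes.result V))
  ; frame = frame-trans ℕ.≤-refl (Computes.frame V) (frame-set ℕ.≤-refl) }
  where
  V  = compileTerm-correct t R
  s₁ = Computes.end V
compileTerm-correct (t ⊞ u) R =
  compileBinary-correct t u _+_ (λ _ → refl) R (compileTerm-correct t) (compileTerm-correct u)
compileTerm-correct (t ⊟ u) R =
  compileBinary-correct t u _∸_ (λ _ → refl) R (compileTerm-correct t) (compileTerm-correct u)
compileTerm-correct {n = n} {A} {ρ} {e} (cond c t u) {r} {s} R =
  -- The value of the test is generalised, because both the branch that runs and the expected result
  -- depend on it.
  select (eval n A e c) (trans (Computes.frame U .keeps ≤1+) (trans (Computes.frame V .keeps ℕ.≤-refl) (Computes.result C)))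
  where
  C  = compileTerm-correct c R
  s₁ = Computes.end C
  R₁ = ready-weaken ≤1+ (ready-frame R (Computes.arrs≡ C) (Computes.frame C))
  V  = compileTerm-correct t R₁
  s₂ = Computes.end V
  R₂ = ready-weaken ≤1+ (ready-frame R₁ (Computes.arrs≡ V) (Computes.frame V))
  U  = compileTerm-correct u R₂
  s₃ = Computes.end U
  fr : Frame r s s₃
  fr = frame-trans ≤2+
         (frame-trans ≤1+ (Computes.frame C) (Computes.frame V)) (Computes.frame U)
  select : ∀ v → vars s₃ r ≡ v →
           Computes (compileTerm (cond c t u) ρ r) s (termTime n (cond c t u)) A r
                    (if≢0 v (eval n A e t) (eval n A e u))
  select zero eq = record
    { run = seq (Computes.run C) (seq (Computes.run V) (seq (Computes.run U) (if-false eq assign)))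
    ; arrs≡ = Computes.arrs≡ U
    ; result = trans (update-same (vars s₃) _ r) (Computes.result U)
    ; frame = frame-trans ℕ.≤-refl fr (frame-set ℕ.≤-refl) }
  select (suc v) eq = record
    { run = seq (Computes.run C) (seq (Computes.run V) (seq (Computes.run U)
              (if-true (λ eq₀ → ℕ.1+n≢0 (trans (sym eq) eq₀)) assign)))
    ; arrs≡ = Computes.arrs≡ U
    ; result = trans (update-same (vars s₃) _ r) (trans (Computes.frame U .keeps ℕ.≤-refl) (Computes.result V))
    ; frame = frame-trans ℕ.≤-refl fr (frame-set ℕ.≤-refl) }
compileTerm-correct {n = n} {A} {ρ} {e} (bind t u) {r} {s} R = record
  { run = seq (Computes.run V) (seq (Computes.run U) assign)
  ; arrs≡ = Computes.arrs≡ U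
  ; result = trans (update-same (vars s₂) _ r) (Computes.result U)
  ; frame = frame-trans ℕ.≤-refl
              (frame-trans ≤1+ (Computes.frame V) (Computes.frame U))
              (frame-set ℕ.≤-refl) }
  where
  V  = compileTerm-correct t R
  s₁ = Computes.end V
  R₁ = ready-bind (ready-frame R (Computes.arrs≡ V) (Computes.frame V)) (Computes.result V)
  U  = compileTerm-correct u R₁
  s₂ = Computes.end U
compileTerm-correct {n = n} {A} {ρ} {e} (∑ t) {r} {s} R = record
  { run = seq assign (seq assign (Computes.run L))
  ; arrs≡ = Computes.arrs≡ L
  ; result = Computes.result L
  ; frame = frame-trans ℕ.≤-refl f₀ (Computes.frame L) }
  where
  s₀ = setVar (1 + r) 0 (setVar r 0 s)
  f₀ : Frame r s s₀
  f₀ = frame-trans ℕ.≤-refl (frame-set ℕ.≤-refl)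
         (frame-set ≤1+)
  body = compileTerm t (1 + r ∷ ρ) (2 + r) ⨾
           ((r ≔ (var r ⊕ var (2 + r))) ⨾ ((1 + r) ≔ (var (1 + r) ⊕ lit 1)))
  f = λ i → eval n A (i ∷ e) t
  -- Loop invariant: `i` rounds are done and `m` are left, register `r` holds the partial sum `acc`,
  -- and register `1 + r` holds the counter `i`.
  go : ∀ m i acc {s} → i + m ≡ n → Ready n A ρ e r s → vars s r ≡ acc → vars s (1 + r) ≡ i →
       Computes (while (var 0 ⊖ var (1 + r)) body) s (loopTime (termTime n t + 2) m) A r
                (acc + sum {m} (λ j → f (i + toℕ j)))
  go zero i acc eqn R eqa eqi = record
    { run = while-false (trans (cong₂ _∸_ (R .order) eqi) (counter-end eqn))
    ; arrs≡ = R .arrays ; result = trans eqa (sym (ℕ.+-identityʳ acc)) ; frame = frame-refl }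
  go (suc m) i acc {s} eqn R eqa eqi = record
    { run = while-true
        (λ eq → ℕ.m>n⇒m∸n≢0 (counter-< eqn) (trans (sym (cong₂ _∸_ (R .order) eqi)) eq))
        (seq (Computes.run B) (seq assign assign)) (Computes.run L)
    ; arrs≡ = Computes.arrs≡ L
    ; result = trans (Computes.result L) (trans (ℕ.+-assoc acc _ _) (cong (acc +_)
        (cong₂ _+_ (cong f (sym (ℕ.+-identityʳ i)))
           (sum-cong-≗ {m} (λ j → cong f (sym (ℕ.+-suc i (toℕ j))))))))
    ; frame = frame-trans ℕ.≤-refl f₃ (Computes.frame L) }
    where
    B  = compileTerm-correct t (ready-bind (ready-weaken ≤1+ R) eqi)
    s₁ = Computes.end B
    s₂ = setVar r (vars s₁ r + vars s₁ (2 + r)) s₁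
    s₃ = setVar (1 + r) (vars s₂ (1 + r) + 1) s₂
    f₃ : Frame r s s₃
    f₃ = frame-trans ℕ.≤-refl
           (frame-trans ℕ.≤-refl (frame-shrink ≤2+ (Computes.frame B))
             (frame-set ℕ.≤-refl))
           (frame-set ≤1+)
    eqa′ : vars s₃ r ≡ acc + f i
    eqa′ = trans (update-other (vars s₂) _ (ℕ.<⇒≢ ℕ.≤-refl)) (trans (update-same (vars s₁) _ r)
             (cong₂ _+_ (trans (Computes.frame B .keeps ≤1+) eqa) (Computes.result B)))
    eqi′ : vars s₃ (1 + r) ≡ suc i
    eqi′ = trans (update-same (vars s₂) _ (1 + r)) (trans (ℕ.+-comm _ 1) (cong suc
             (trans (update-other (vars s₁) _ (λ eq → ℕ.<⇒≢ ℕ.≤-refl (sym eq)))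
               (trans (Computes.frame B .keeps ℕ.≤-refl) eqi))))
    L  = go m (suc i) (acc + f i) (counter-suc eqn)
           (ready-frame R (Computes.arrs≡ B) f₃) eqa′ eqi′
  L = go n 0 0 refl (ready-frame R (R .arrays) f₀)
        (trans (update-other (vars (setVar r 0 s)) 0 (ℕ.<⇒≢ ℕ.≤-refl)) (update-same (vars s) 0 r))
        (update-same (vars (setVar r 0 s)) 0 (1 + r))

compile-correct : ∀ {d n A} {ρ e : Vec ℕ d} (c : Command d) → ∀ {r s} → Ready n A ρ e r s →
                  Executes (compile c ρ r) s (time n c) (exec n e c A) r
compile-correct {n = n} {A} {ρ} {e} (put a t u) {r} {s} R = record
  { run = seq (Computes.run V) (seq (Computes.run U) Run.store)
  ; arrs≡ = cong₂ (λ (v , w) B → setArr a v w B)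
              (cong₂ _,_ (trans (Computes.frame U .keeps ℕ.≤-refl) (Computes.result V)) (Computes.result U))
              (Computes.arrs≡ U)
  ; frame = record { keeps = frame-trans ≤1+ (Computes.frame V) (Computes.frame U) .keeps } }
  where
  V  = compileTerm-correct t R
  s₁ = Computes.end V
  R₁ = ready-weaken ≤1+ (ready-frame R (Computes.arrs≡ V) (Computes.frame V))
  U  = compileTerm-correct u R₁
  s₂ = Computes.end U
compile-correct (c ﹔ d) {r} {s} R = record
  { run = seq (Executes.run C) (Executes.run D)
  ; arrs≡ = Executes.arrs≡ D
  ; frame = frame-trans ℕ.≤-refl
              (Executes.frame C) (Executes.frame D) }
  where
  C = compile-correct c R
  D = compile-correct d (ready-frame R (Executes.arrs≡ C) (Executes.frame C))
compile-correct {n = n} {A} {ρ} {e} (loop c) {r} {s} R = record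
  { run = seq assign (Executes.run L)
  ; arrs≡ = Executes.arrs≡ L
  ; frame = frame-trans ℕ.≤-refl
              (frame-set ℕ.≤-refl) (Executes.frame L) }
  where
  body = compile c (r ∷ ρ) (1 + r) ⨾ (r ≔ (var r ⊕ lit 1))
  go : ∀ m i {A s} → i + m ≡ n → Ready n A ρ e r s → vars s r ≡ i →
       Executes (while (var 0 ⊖ var r) body) s (loopTime (time n c + 1) m)
                (repeat (λ i → exec n (i ∷ e) c) i m A) r
  go zero i eqn R eqi = record
    { run = while-false (trans (cong₂ _∸_ (R .order) eqi) (counter-end eqn))
    ; arrs≡ = R .arrays ; frame = frame-refl }
  go (suc m) i {s = s} eqn R eqi = record
    { run = while-true
        (λ eq → ℕ.m>n⇒m∸n≢0 (counter-< eqn) (trans (sym (cong₂ _∸_ (R .order) eqi)) eq))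
        (seq (Executes.run B) assign) (Executes.run L)
    ; arrs≡ = Executes.arrs≡ L
    ; frame = frame-trans ℕ.≤-refl f₂ (Executes.frame L) }
    where
    B  = compile-correct c (ready-bind R eqi)
    s₁ = Executes.end B
    s₂ = setVar r (vars s₁ r + 1) s₁
    f₂ : Frame r s s₂
    f₂ = frame-trans ℕ.≤-refl (frame-shrink ≤1+ (Executes.frame B))
           (frame-set ℕ.≤-refl)
    L  = go m (suc i) (counter-suc eqn) (ready-frame R (Executes.arrs≡ B) f₂)
           (trans (update-same (vars s₁) _ r)
             (trans (ℕ.+-comm _ 1) (cong suc (trans (Executes.frame B .keeps ℕ.≤-refl) eqi))))
  L = go n 0 refl (ready-frame R (R .arrays) (frame-set ℕ.≤-refl)) (update-same (vars s) 0 r)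

-- Polynomial time bounds

-- The base `suc n` is positive, so its powers grow with the exponent and bounds of different
-- degrees can be added.
Polynomial : (ℕ → ℕ) → Set
Polynomial f = ∃[ c ] ∃[ k ] ∀ n → f n ≤ c * suc n ^ k

const-polynomial : ∀ c → Polynomial (λ _ → c)
const-polynomial c = c , 0 , λ n → ℕ.≤-reflexive (sym (ℕ.*-identityʳ c))

+-polynomial : ∀ {f g} → Polynomial f → Polynomial g → Polynomial (λ n → f n + g n)
+-polynomial {f} {g} (c , k , p) (d , l , q) = c + d , k + l , λ n → begin
  f n + g n                                ≤⟨ ℕ.+-mono-≤ (p n) (q n) ⟩
  c * suc n ^ k + d * suc n ^ l            ≤⟨ ℕ.+-mono-≤
    (ℕ.*-monoʳ-≤ c (ℕ.^-monoʳ-≤ (suc n) (ℕ.m≤m+n k l)))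
    (ℕ.*-monoʳ-≤ d (ℕ.^-monoʳ-≤ (suc n) (ℕ.m≤n+m l k))) ⟩
  c * suc n ^ (k + l) + d * suc n ^ (k + l) ≡⟨ ℕ.*-distribʳ-+ (suc n ^ (k + l)) c d ⟨
  (c + d) * suc n ^ (k + l)                ∎
  where open ℕ.≤-Reasoning

loopTime-bound : ∀ t m → loopTime t m ≤ (1 + t) * suc m
loopTime-bound t zero    = s≤s z≤n
loopTime-bound t (suc m) = begin
  suc (t + loopTime t m)       ≤⟨ s≤s (ℕ.+-monoʳ-≤ t (loopTime-bound t m)) ⟩
  (1 + t) + (1 + t) * suc m    ≡⟨ ℕ.*-suc (1 + t) (suc m) ⟨
  (1 + t) * suc (suc m)        ∎
  where open ℕ.≤-Reasoning

loopTime-polynomial : ∀ {f} → Polynomial f → Polynomial (λ n → loopTime (f n) n)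
loopTime-polynomial {f} p with +-polynomial (const-polynomial 1) p
... | c , k , q = c , suc k , λ n → begin
  loopTime (f n) n          ≤⟨ loopTime-bound (f n) n ⟩
  (1 + f n) * suc n         ≤⟨ ℕ.*-monoˡ-≤ (suc n) (q n) ⟩
  c * suc n ^ k * suc n     ≡⟨ ℕ.*-assoc c _ _ ⟩
  c * (suc n ^ k * suc n)   ≡⟨ cong (c *_) (ℕ.*-comm (suc n ^ k) (suc n)) ⟩
  c * suc n ^ suc k         ∎
  where open ℕ.≤-Reasoning

termTime-polynomial : ∀ {d} (t : Term d) → Polynomial (λ n → termTime n t)
termTime-polynomial (num c)      = const-polynomial 1
termTime-polynomial (at i)       = const-polynomial 1
termTime-polynomial (get a t)    = +-polynomial (termTime-polynomial t) (const-polynomial 1)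
termTime-polynomial (t ⊞ u)      = +-polynomial (termTime-polynomial t)
  (+-polynomial (termTime-polynomial u) (const-polynomial 1))
termTime-polynomial (t ⊟ u)      = +-polynomial (termTime-polynomial t)
  (+-polynomial (termTime-polynomial u) (const-polynomial 1))
termTime-polynomial (cond c t u) = +-polynomial (termTime-polynomial c)
  (+-polynomial (termTime-polynomial t) (+-polynomial (termTime-polynomial u) (const-polynomial 2)))
termTime-polynomial (bind t u)   = +-polynomial (termTime-polynomial t)
  (+-polynomial (termTime-polynomial u) (const-polynomial 1))
termTime-polynomial (∑ t)        = +-polynomial (const-polynomial 2)
  (loopTime-polynomial (+-polynomial (termTime-polynomial t) (const-polynomial 2)))

time-polynomial : ∀ {d} (c : Command d) → Polynomial (λ n → time n c)
time-polynomial (put a t u) = +-polynomial (termTime-polynomial t)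
  (+-polynomial (termTime-polynomial u) (const-polynomial 1))
time-polynomial (c ﹔ d)    = +-polynomial (time-polynomial c) (time-polynomial d)
time-polynomial (loop c)    = +-polynomial (const-polynomial 1)
  (loopTime-polynomial (+-polynomial (time-polynomial c) (const-polynomial 1)))

-- The size n² + 1 is at least n + 1. One number has to serve as coefficient, exponent and additive
-- constant; the sum of coefficient and degree is large enough for all three.
polynomial-in-size : ∀ {f} → Polynomial f →
                     ∃[ k ] ∀ n → f n ≤ k * suc (n * n) ^ k + k
polynomial-in-size {f} (c , l , p) = c + l , λ n → begin
  f n                                     ≤⟨ p n ⟩
  c * suc n ^ l                           ≤⟨ ℕ.*-monoʳ-≤ c (ℕ.^-monoˡ-≤ l (s≤s (n≤n² n))) ⟩
  c * suc (n * n) ^ l                     ≤⟨ ℕ.*-mono-≤ (ℕ.m≤m+n c l)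
                                               (ℕ.^-monoʳ-≤ (suc (n * n)) (ℕ.m≤n+m l c)) ⟩
  (c + l) * suc (n * n) ^ (c + l)         ≤⟨ ℕ.m≤m+n _ (c + l) ⟩
  (c + l) * suc (n * n) ^ (c + l) + (c + l) ∎
  where
  open ℕ.≤-Reasoning
  n≤n² : ∀ n → n ≤ n * n
  n≤n² zero    = z≤n
  n≤n² (suc n) = ℕ.m≤m*n (suc n) (suc n)

-- Filling an array indexed by triples

sum-const : ∀ n c → sum {n} (λ _ → c) ≡ n * c
sum-const zero    c = refl
sum-const (suc n) c = cong (c +_) (sum-const n c)

repeat-invariant : ∀ {A : Set} {f : ℕ → A → A} {n} (P : ℕ → A → Set) →
                   (∀ i x → i < n → P i x → P (suc i) (f i x)) →
                   ∀ {x} → P 0 x → P n (repeat f 0 n x)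
repeat-invariant {A} {f} {n} P step p = go n 0 refl p
  where
  go : ∀ m i {x} → i + m ≡ n → P i x → P n (repeat f i m x)
  go zero    i {x} eq p = subst (λ k → P k x) (trans (sym (ℕ.+-identityʳ i)) eq) p
  go (suc m) i     eq p = go m (suc i) (counter-suc eq) (step i _ (counter-< eq) p)

setArr-other : ∀ {a b i v A} → b ≢ a → setArr a i v A b ≡ A b
setArr-other {A = A} b≢a = update-other A _ b≢a

setArr-same : ∀ a i v A → setArr a i v A a ≡ update i v (A a)
setArr-same a i v A = update-same A _ a

-- Multiplication by `n` as an `n`-fold sum, since the machine only adds and subtracts. The `bind`
-- evaluates `t` once instead of `n` times.
scale : ∀ {d} → Term d → Term d
scale t = bind t (∑ (at (suc zero)))

eval-scale : ∀ {d} n A (e : Vec ℕ d) t → eval n A e (scale t) ≡ n * eval n A e t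
eval-scale n A e t = sum-const n (eval n A e t)

cell₂ : ∀ {d} → Term d → Term d → Term d
cell₂ t u = scale t ⊞ u

cell₃ : ∀ {d} → Term d → Term d → Term d → Term d
cell₃ t u v = cell₂ (cell₂ t u) v

-- The numeral with digits `k`, `x`, `y` in base `n`, so that numerical order of cells is
-- lexicographic order of triples.
position : ℕ → ℕ → ℕ → ℕ → ℕ
position n k x y = n * (n * k + x) + y

eval-cell₂ : ∀ {d} n A (e : Vec ℕ d) t u →
             eval n A e (cell₂ t u) ≡ n * eval n A e t + eval n A e u
eval-cell₂ n A e t u = cong (_+ eval n A e u) (eval-scale n A e t)

eval-cell₃ : ∀ {d} n A (e : Vec ℕ d) t u v →
             eval n A e (cell₃ t u v) ≡ position n (eval n A e t) (eval n A e u) (eval n A e v)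
eval-cell₃ n A e t u v = trans (eval-cell₂ n A e (cell₂ t u) v)
  (cong (λ m → n * m + eval n A e v) (eval-cell₂ n A e t u))

lex-< : ∀ {n m m′ y} y′ → y < n → m < m′ → n * m + y < n * m′ + y′
lex-< {n} {m} {m′} {y} y′ y<n m<m′ = begin-strict
  n * m + y     <⟨ ℕ.+-monoʳ-< (n * m) y<n ⟩
  n * m + n     ≡⟨ ℕ.+-comm (n * m) n ⟩
  n + n * m     ≡⟨ ℕ.*-suc n m ⟨
  n * suc m     ≤⟨ ℕ.*-monoʳ-≤ n m<m′ ⟩
  n * m′        ≤⟨ ℕ.m≤m+n (n * m′) y′ ⟩
  n * m′ + y′   ∎
  where open ℕ.≤-Reasoning

lex-injective : ∀ {n m m′ y y′} → y < n → y′ < n → n * m + y ≡ n * m′ + y′ → m ≡ m′ × y ≡ y′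
lex-injective {n} {m} {m′} {y} {y′} y<n y′<n eq with ℕ.<-cmp m m′
... | tri< m<m′ _ _ = contradiction eq (ℕ.<⇒≢ (lex-< y′ y<n m<m′))
... | tri≈ _ refl _ = refl , ℕ.+-cancelˡ-≡ (n * m) y y′ eq
... | tri> _ _ m′<m = contradiction (sym eq) (ℕ.<⇒≢ (lex-< y y′<n m′<m))

position-mono : ∀ {n k k′ x y} x′ y′ → x < n → y < n → k < k′ →
                position n k x y < position n k′ x′ y′
position-mono x′ y′ x<n y<n k<k′ = lex-< y′ y<n (lex-< x′ x<n k<k′)

position-injective : ∀ {n k x y k′ x′ y′} → x < n → y < n → x′ < n → y′ < n →
                     position n k x y ≡ position n k′ x′ y′ → k ≡ k′ × x ≡ x′ × y ≡ y′
position-injective x<n y<n x′<n y′<n eq with m≡ , y≡ ← lex-injective y<n y′<n eq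
  with k≡ , x≡ ← lex-injective x<n x′<n m≡ = k≡ , x≡ , y≡

lex-suc : ∀ n m → n * m + n ≡ n * suc m + 0
lex-suc n m = trans (ℕ.+-comm (n * m) n) (trans (sym (ℕ.*-suc n m)) (sym (ℕ.+-identityʳ (n * suc m))))

-- Evaluates t, whose variables are y, x and k, for all k, x, y < n in
-- lexicographic order, so that t may refer to the results for smaller k.
current : ∀ {d} → Term (3 + d)
current = cell₃ (at (suc (suc zero))) (at (suc zero)) (at zero)

fill : ∀ {d} → ℕ → Term (3 + d) → Command d
fill a t = loop (loop (loop (put a current t)))

Unchanged : ℕ → Arrays → Arrays → Set
Unchanged a A B = ∀ {b} → b ≢ a → B b ≡ A b

module _ {n : ℕ} (a : ℕ) (A : Arrays) (f : ℕ → ℕ → ℕ → ℕ) (t : Term 3)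
  (computes : ∀ B k x y → k < n → x < n → y < n → Unchanged a A B →
    (∀ {k′ x′ y′} → k′ < k → x′ < n → y′ < n → B a (position n k′ x′ y′) ≡ f k′ x′ y′) →
    eval n B (y ∷ x ∷ k ∷ []) t ≡ f k x y)
  where

  private
    FilledBelow : ℕ → Arrays → Set
    FilledBelow c B = Unchanged a A B ×
      (∀ {k x y} → x < n → y < n → position n k x y < c → B a (position n k x y) ≡ f k x y)

    set-cell : ∀ {k x y B} → k < n → x < n → y < n → FilledBelow (position n k x y) B →
               FilledBelow (suc (position n k x y))
                 (exec n (y ∷ x ∷ k ∷ []) (put a current t) B)
    set-cell {k} {x} {y} {B} k<n x<n y<n (same , filled) = (λ b≢a → trans (setArr-other {A = B} b≢a) (same b≢a)) , filled′
      where
      e = y ∷ x ∷ k ∷ []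
      c = eval n B e current
      c≡ : c ≡ position n k x y
      c≡ = eval-cell₃ n B e (at (suc (suc zero))) (at (suc zero)) (at zero)
      v = eval n B e t
      filled′ : ∀ {k′ x′ y′} → x′ < n → y′ < n → position n k′ x′ y′ < suc (position n k x y) →
                setArr a c v B a (position n k′ x′ y′) ≡ f k′ x′ y′
      filled′ {k′} {x′} {y′} x′<n y′<n (s≤s p≤) rewrite setArr-same a c v B | c≡
        with ℕ.m≤n⇒m<n∨m≡n p≤
      ... | inj₁ p< = trans (update-other (B a) v (ℕ.<⇒≢ p<)) (filled x′<n y′<n p<)
      ... | inj₂ p≡ with refl , refl , refl ← position-injective x′<n y′<n x<n y<n p≡ =
        trans (update-same (B a) v (position n k x y))
          (computes B k x y k<n x<n y<n same
            -- A smaller first index means a smaller position whatever the other two are, so every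
            -- cell that `t` may consult is already filled.
            (λ k″<k x″<n y″<n → filled x″<n y″<n (position-mono x y x″<n y″<n k″<k)))

  -- The three loops visit the cells in increasing order of `position`. One invariant, that all
  -- cells below a bound are filled, therefore serves all of them; the end of each row is identified
  -- with the start of the next.
  fill-correct : let B = exec n [] (fill a t) A in
                 Unchanged a A B ×
                 (∀ {k x y} → k < n → x < n → y < n → B a (position n k x y) ≡ f k x y)
  fill-correct = proj₁ filled , λ k<n x<n y<n → proj₂ filled x<n y<n (position-mono 0 0 x<n y<n k<n)
    where
    filled : FilledBelow (position n n 0 0) (exec n [] (fill a t) A)
    filled = repeat-invariant (λ k → FilledBelow (position n k 0 0)) (λ k B k<n p →
      subst (λ c → FilledBelow c (exec n (k ∷ []) (loop (loop (put a current t))) B)) (row k)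
       (repeat-invariant (λ x → FilledBelow (position n k x 0)) (λ x B x<n p →
        subst (λ c → FilledBelow c (exec n (x ∷ k ∷ []) (loop (put a current t)) B)) (lex-suc′ k x)
         (repeat-invariant (λ y → FilledBelow (position n k x y)) (λ y B y<n p →
          subst (λ c → FilledBelow c (exec n (y ∷ x ∷ k ∷ []) (put a current t) B)) (sym (ℕ.+-suc (n * (n * k + x)) y))
            (set-cell k<n x<n y<n p)) p)) p))
      ((λ _ → refl) , λ x<n y<n p< → contradiction p< (λ q → ℕ.n≮0 (ℕ.<-≤-trans q (ℕ.≤-reflexive zero-start))))
      where
      zero-start : position n 0 0 0 ≡ 0
      zero-start rewrite ℕ.*-zeroʳ n | ℕ.*-zeroʳ n = refl
      lex-suc′ : ∀ k x → position n k x n ≡ position n k (suc x) 0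
      lex-suc′ k x = trans (lex-suc n (n * k + x)) (cong (λ m → n * m + 0) (sym (ℕ.+-suc (n * k) x)))
      row : ∀ k → position n k n 0 ≡ position n (suc k) 0 0
      row k = cong (λ m → n * m + 0) (lex-suc n k)

-- Walks, distances and monitoring

module _ {G : Graph} where

  snoc : ∀ {x y z k} → Walk G x y k → Adj G y z → Walk G x z (suc k)
  snoc nil         e = cons e nil
  snoc (cons f w)  e = cons f (snoc w e)

  unsnoc : ∀ {x z k} → Walk G x z (suc k) → ∃[ y ] Walk G x y k × Adj G y z
  unsnoc (cons e nil)          = _ , nil , e
  unsnoc (cons e w@(cons _ _)) with y , w′ , f ← unsnoc w = y , cons e w′ , f

  append : ∀ {x y z k l} → Walk G x y k → Walk G y z l → Walk G x z (k + l)
  append nil        v = v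
  append (cons e w) v = cons e (append w v)

  vertexAt : ∀ {x y k} → Walk G x y k → Fin (suc k) → Vertex G
  vertexAt {x} w          zero    = x
  vertexAt     (cons e w) (suc i) = vertexAt w i

  take : ∀ {x y k} (w : Walk G x y k) i → Walk G x (vertexAt w i) (toℕ i)
  take w          zero    = nil
  take (cons e w) (suc i) = cons e (take w i)

  drop : ∀ {x y k} (w : Walk G x y k) i → ∃[ l ] l + toℕ i ≡ k × Walk G (vertexAt w i) y l
  drop w          zero    = _ , ℕ.+-identityʳ _ , w
  drop (cons e w) (suc i) with l , eq , v ← drop w i = l , trans (ℕ.+-suc l (toℕ i)) (cong suc eq) , v

  -- The walk has more than `order G` vertices, so two coincide and the closed walk between them can
  -- be cut out.
  shorten : ∀ {x y k} → order G ≤ k → Walk G x y k → ∃[ l ] l < k × Walk G x y l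
  shorten {y = y} {k} n≤k w with pigeonhole (s≤s n≤k) (vertexAt w)
  ... | i , j , i<j , eq with drop w j
  ...   | l , l+j≡k , v = toℕ i + l ,
    (begin-strict
      toℕ i + l   <⟨ ℕ.+-monoˡ-< l i<j ⟩
      toℕ j + l   ≡⟨ ℕ.+-comm (toℕ j) l ⟩
      l + toℕ j   ≡⟨ l+j≡k ⟩
      k           ∎) ,
    append (take w i) (subst (λ z → Walk G z y l) (sym eq) v)
    where open ℕ.≤-Reasoning

  walk? : ∀ k x y → Dec (Walk G x y k)
  walk? zero x y with x ≟ y
  ... | yes refl = yes nil
  ... | no  x≢y  = no λ { nil → x≢y refl }
  walk? (suc k) x y with any? (λ z → T? (adj G x z) ×-dec walk? k z y)
  ... | yes (z , e , w) = yes (cons e w)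
  ... | no  ∄z          = no λ { (cons e w) → ∄z (_ , e , w) }

  distance-below : ∀ x y m → (∃[ k ] IsDistance G x y [ k ]) ⊎ (∀ k → k < m → ¬ Walk G x y k)
  distance-below x y zero = inj₂ (λ _ ())
  distance-below x y (suc m) with distance-below x y m
  ... | inj₁ found = inj₁ found
  ... | inj₂ none with walk? m x y
  ...   | yes w = inj₁ (m , w , λ j v → ℕ.≮⇒≥ (λ j<m → none j j<m v))
  ...   | no ∄w = inj₂ none′
    where
    none′ : ∀ k → k < suc m → ¬ Walk G x y k
    none′ k (s≤s k≤m) w with ℕ.m≤n⇒m<n∨m≡n k≤m
    ... | inj₁ k<m  = none k k<m w
    ... | inj₂ refl = ∄w w

  shortWalk : ∀ {x y} k → Walk G x y k → ∃[ l ] l < order G × Walk G x y l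
  shortWalk {x} {y} = <-rec _ go
    where
    go : ∀ k → (∀ {l} → l < k → Walk G x y l → _) → Walk G x y k → ∃[ l ] l < order G × Walk G x y l
    go k rec w with k ℕ.<? order G
    ... | yes k<n = k , k<n , w
    ... | no  k≮n with l , l<k , v ← shorten (ℕ.≮⇒≥ k≮n) w = rec l<k v

  -- `Monitors` asks for the distance after the deletion as well, so it has to be found by a search.
  -- Lengths below the order suffice: by `shortWalk`, any walk yields one that short.
  distance : ∀ x y → ∃[ d ] IsDistance G x y d
  distance x y with distance-below x y (order G)
  ... | inj₁ (k , d) = [ k ] , d
  ... | inj₂ none    = ⊤⁺ , λ j w → let l , l<n , v = shortWalk j w in none l l<n v

  distance<order : ∀ {x y k} → IsDistance G x y [ k ] → k < order G
  distance<order (w , min) with l , l<n , v ← shortWalk _ w = ℕ.≤-<-trans (min l v) l<n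

  loopless : ∀ {u v} → Adj G u v → u ≢ v
  loopless {u} e refl = subst T (adj-irrefl G u) e

  adj-swap : ∀ {u v} → Adj G u v → Adj G v u
  adj-swap {u} {v} = subst T (adj-sym G u v)

module _ {G : Graph} where

  -- All shortest walks from x to b arrive through a.
  Critical : Vertex G → Vertex G → Vertex G → Set
  Critical x a b = ∃[ k ] Walk G x a k × (∀ j → j ≤ k → ¬ Walk G x b j)
                   × (∀ a′ → Adj G a′ b → Walk G x a′ k → a′ ≡ a)

  -- A shorter walk to `a`, continued along the edge to `b`, would reach `b` within `k` steps.
  critical⇒distance : ∀ {x a b k} → Adj G a b → Walk G x a k → (∀ j → j ≤ k → ¬ Walk G x b j) →
                      IsDistance G x a [ k ]
  critical⇒distance e w far = w , λ j v → ℕ.≮⇒≥ (λ j<k → far (suc j) j<k (snoc v e))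

  embed : ∀ {c d x y k} → Walk (deleteEdge G c d) x y k → Walk G x y k
  embed nil        = nil
  embed (cons e w) = cons (proj₁ (Equivalence.to T-∧ e)) (embed w)

  -- Without the edge from `a` to `b`, a walk of length k + 1 to `b` would have to arrive through
  -- another neighbour, against uniqueness. The deleted edge is named `c`, `d` separately since it
  -- may be listed in either direction.
  critical⇒monitors : ∀ {c d x a b} → Adj G a b → ¬ Adj (deleteEdge G c d) a b →
                      Critical x a b → Monitors G x c d
  critical⇒monitors {c} {d} {x} {a} {b} e ¬e (k , w , far , unique) =
    b , [ suc k ] , proj₁ δ ,
    (snoc w e , λ j v → ℕ.≰⇒> (λ j≤k → far j j≤k v)) , proj₂ δ ,
    λ eq → absurd (subst (IsDistance (deleteEdge G c d) x b) (sym eq) (proj₂ δ))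
    where
    δ = distance x b
    absurd : ¬ IsDistance (deleteEdge G c d) x b [ suc k ]
    absurd (v , _) with a′ , v′ , e′ ← unsnoc v
      with refl ← unique a′ (proj₁ (Equivalence.to T-∧ e′)) (embed v′) = ¬e e′

  sameEdge-refl : ∀ {n} (a b : Fin n) → T (sameEdge a b a b)
  sameEdge-refl a b with a ≟ a | b ≟ b
  ... | yes _   | yes _   = _
  ... | yes _   | no b≢b  = contradiction refl b≢b
  ... | no a≢a  | _       = contradiction refl a≢a

  sameEdge-swap : ∀ {n} (a b : Fin n) → T (sameEdge a b b a)
  sameEdge-swap a b = subst T (∨-comm (⌊ a ≟ a ⌋ ∧ ⌊ b ≟ b ⌋) (⌊ b ≟ a ⌋ ∧ ⌊ a ≟ b ⌋)) (sameEdge-refl a b)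

  sameEdge⇒ : ∀ {n} (a b u v : Fin n) → T (sameEdge a b u v) → (u ≡ a × v ≡ b) ⊎ (v ≡ a × u ≡ b)
  sameEdge⇒ a b u v t with u ≟ a | v ≟ b | v ≟ a | u ≟ b
  ... | yes p | yes q | _     | _     = inj₁ (p , q)
  ... | _     | _     | yes p | yes q = inj₂ (p , q)
  sameEdge⇒ a b u v () | yes _ | no _ | no _  | _
  sameEdge⇒ a b u v () | yes _ | no _ | yes _ | no _
  sameEdge⇒ a b u v () | no _  | _    | no _  | _
  sameEdge⇒ a b u v () | no _  | _    | yes _ | no _

  deleted : ∀ {a b u v} → T (sameEdge a b u v) → ¬ Adj (deleteEdge G a b) u v
  deleted {a} {b} {u} {v} s e with sameEdge a b u v | proj₂ (Equivalence.to (T-∧ {adj G u v}) e)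
  ... | true | ()

  kept : ∀ {a b u v} → Adj G u v → ¬ T (sameEdge a b u v) → Adj (deleteEdge G a b) u v
  kept {a} {b} {u} {v} e ¬s with sameEdge a b u v
  ... | true  = contradiction _ ¬s
  ... | false = Equivalence.from T-∧ (e , _)

  -- A finite search turns the negation of `Critical` into an actual second neighbour through which
  -- `b` is reached equally early.
  detour : ∀ {x a b k} → ¬ Critical x a b → Walk G x a k → (∀ j → j ≤ k → ¬ Walk G x b j) →
           ∃[ a′ ] Adj G a′ b × Walk G x a′ k × a′ ≢ a
  detour {x} {a} {b} {k} ¬crit w far
    with any? (λ a′ → T? (adj G a′ b) ×-dec walk? k x a′ ×-dec ¬? (a′ ≟ a))
  ... | yes found = found
  ... | no  ∄a′   = contradiction (k , w , far , unique) ¬crit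
    where
    unique : ∀ a′ → Adj G a′ b → Walk G x a′ k → a′ ≡ a
    unique a′ e v with a′ ≟ a
    ... | yes eq = eq
    ... | no  ne = contradiction (a′ , e , v , ne) ∄a′

  -- Induction on the distance. If the last step of a shortest walk is the edge in question,
  -- `detour` supplies another last step from a vertex at the same distance; the walk up to there
  -- avoids the edge by induction.
  avoid : ∀ {x a b} → ¬ Critical x a b → ¬ Critical x b a →
          ∀ k y → IsDistance G x y [ k ] → Walk (deleteEdge G a b) x y k
  avoid ¬ab ¬ba zero y (nil , _) = nil
  avoid {x} {a} {b} ¬ab ¬ba (suc k) y (w , min) with unsnoc w
  ... | z , v , e = arrive (T? (sameEdge a b z y))
    where
    far : ∀ j → j ≤ k → ¬ Walk G x y j
    far j j≤k u = ℕ.<⇒≱ (s≤s j≤k) (min j u)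
    from : ∀ {z} → Adj G z y → Walk G x z k → ¬ T (sameEdge a b z y) → Walk (deleteEdge G a b) x y (suc k)
    from e v ¬s = snoc (avoid ¬ab ¬ba k _ (critical⇒distance e v far)) (kept e ¬s)
    arrive : Dec (T (sameEdge a b z y)) → Walk (deleteEdge G a b) x y (suc k)
    arrive (no ¬s) = from e v ¬s
    arrive (yes s) with sameEdge⇒ a b z y s
    ... | inj₁ (refl , refl) with a′ , e′ , v′ , a′≢a ← detour ¬ab v far =
      from e′ v′ λ s′ → case-⊥ a′≢a (loopless {G} e′) (sameEdge⇒ a b a′ b s′)
      where
      case-⊥ : ∀ {a′} → a′ ≢ a → a′ ≢ b → (a′ ≡ a × b ≡ b) ⊎ (b ≡ a × a′ ≡ b) → ⊥
      case-⊥ p q (inj₁ (r , _)) = p r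
      case-⊥ p q (inj₂ (_ , r)) = q r
    ... | inj₂ (refl , refl) with b′ , e′ , v′ , b′≢b ← detour ¬ba v far =
      from e′ v′ λ s′ → case-⊥ b′≢b (loopless {G} e′) (sameEdge⇒ a b b′ a s′)
      where
      case-⊥ : ∀ {b′} → b′ ≢ b → b′ ≢ a → (b′ ≡ a × a ≡ b) ⊎ (a ≡ a × b′ ≡ b) → ⊥
      case-⊥ p q (inj₁ (r , _)) = q r
      case-⊥ p q (inj₂ (_ , r)) = p r

  -- Deleting an edge creates no walks, and `avoid` preserves the length of a shortest one. Hence
  -- the two distances agree, also when they are infinite.
  ¬critical⇒¬monitors : ∀ {x a b} → ¬ Critical x a b → ¬ Critical x b a → ¬ Monitors G x a b
  ¬critical⇒¬monitors ¬ab ¬ba (y , [ k ] , [ l ] , (w , min) , (w′ , min′) , k≢l) =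
    k≢l (cong [_] (ℕ.≤-antisym (min l (embed w′)) (min′ k (avoid ¬ab ¬ba k y (w , min)))))
  ¬critical⇒¬monitors ¬ab ¬ba (y , [ k ] , ⊤⁺    , δ , none , _) = none k (avoid ¬ab ¬ba k y δ)
  ¬critical⇒¬monitors ¬ab ¬ba (y , ⊤⁺    , [ l ] , none , (w , _) , _) = none l (embed w)
  ¬critical⇒¬monitors ¬ab ¬ba (y , ⊤⁺    , ⊤⁺    , _ , _ , d≢d′) = d≢d′ refl

  critical-self : ∀ {a b} → Adj G a b → Critical a a b
  critical-self {a} {b} e = 0 , nil , (λ { .0 z≤n nil → loopless {G} e refl }) , λ { _ _ nil → refl }

-- Numbers as truth values: nonzero is true, a sum is an existential quantifier

sum≢0⇒ : ∀ {n} (f : Fin n → ℕ) → sum f ≢ 0 → ∃[ i ] f i ≢ 0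
sum≢0⇒ {zero}  f Σ≢0 = contradiction refl Σ≢0
sum≢0⇒ {suc n} f Σ≢0 with f zero ℕ.≟ 0
... | no  f₀≢0 = zero , f₀≢0
... | yes f₀≡0 with i , fᵢ≢0 ← sum≢0⇒ (λ i → f (suc i)) (λ eq → Σ≢0 (cong₂ _+_ f₀≡0 eq)) = suc i , fᵢ≢0

⇒sum≢0 : ∀ {n} (f : Fin n → ℕ) i → f i ≢ 0 → sum f ≢ 0
⇒sum≢0 f zero    fᵢ≢0 eq = fᵢ≢0 (ℕ.m+n≡0⇒m≡0 (f zero) eq)
⇒sum≢0 f (suc i) fᵢ≢0 eq = ⇒sum≢0 (λ i → f (suc i)) i fᵢ≢0 (ℕ.m+n≡0⇒n≡0 (f zero) eq)

⇒sum≡0 : ∀ {n} (f : Fin n → ℕ) → (∀ i → f i ≡ 0) → sum f ≡ 0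
⇒sum≡0 f fᵢ≡0 with sum f ℕ.≟ 0
... | yes Σ≡0 = Σ≡0
... | no  Σ≢0 with i , fᵢ≢0 ← sum≢0⇒ f Σ≢0 = contradiction (fᵢ≡0 i) fᵢ≢0

sum≡0⇒ : ∀ {n} (f : Fin n → ℕ) → sum f ≡ 0 → ∀ i → f i ≡ 0
sum≡0⇒ f Σ≡0 i with f i ℕ.≟ 0
... | yes fᵢ≡0 = fᵢ≡0
... | no  fᵢ≢0 = contradiction Σ≡0 (⇒sum≢0 f i fᵢ≢0)

and⇒ : ∀ c {t} → if≢0 c t 0 ≢ 0 → c ≢ 0 × t ≢ 0
and⇒ zero  ne = contradiction refl ne
and⇒ (suc c) ne = (λ ()) , ne

⇒and : ∀ c {t} → c ≢ 0 → t ≢ 0 → if≢0 c t 0 ≢ 0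
⇒and zero     c≢0 t≢0 = contradiction refl c≢0
⇒and (suc c) c≢0 t≢0 = t≢0

unless⇒ : ∀ c {t} → if≢0 c 0 t ≢ 0 → c ≡ 0 × t ≢ 0
unless⇒ zero  ne = refl , ne
unless⇒ (suc c) ne = contradiction refl ne

⇒unless : ∀ c {t} → c ≡ 0 → t ≢ 0 → if≢0 c 0 t ≢ 0
⇒unless c refl t≢0 = t≢0

equal : ℕ → ℕ → ℕ
equal x y = 1 ∸ ((x ∸ y) + (y ∸ x))

equal-refl : ∀ x → equal x x ≢ 0
equal-refl x eq rewrite ℕ.n∸n≡0 x with () ← eq

equal⇒≡ : ∀ x y → equal x y ≢ 0 → x ≡ y
equal⇒≡ x y ne with (x ∸ y) + (y ∸ x) in eq
... | zero  = ℕ.≤-antisym (ℕ.m∸n≡0⇒m≤n (ℕ.m+n≡0⇒m≡0 (x ∸ y) eq)) (ℕ.m∸n≡0⇒m≤n (ℕ.m+n≡0⇒n≡0 (x ∸ y) eq))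
... | suc m = contradiction (ℕ.0∸n≡0 m) ne

-- Monitoring as a numerical test

module Numeric (n : ℕ) (edge : ℕ → ℕ → ℕ) where

  -- Nonzero iff there is a walk of length k from x to y; it does not count the
  -- walks, since that would need a multiplication.
  walks : ℕ → ℕ → ℕ → ℕ
  walks zero    x y = equal x y
  walks (suc k) x y = sum {n} λ z → if≢0 (walks k x (toℕ z)) (edge (toℕ z) y) 0

  -- The factor `suc k ∸ toℕ j` tests j ≤ k. Letting j run below `n` loses nothing when k < n.
  earlyWalks : ℕ → ℕ → ℕ → ℕ
  earlyWalks x b k = sum {n} λ j → if≢0 (suc k ∸ toℕ j) (walks (toℕ j) x b) 0

  rivalWalks : ℕ → ℕ → ℕ → ℕ → ℕ
  rivalWalks x a b k = sum {n} λ a′ → if≢0 (edge (toℕ a′) b)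
    (if≢0 (equal (toℕ a′) a) 0 (walks k x (toℕ a′))) 0

  -- Nonzero iff k is a witness of Critical x a b
  criticalAt : ℕ → ℕ → ℕ → ℕ → ℕ
  criticalAt x a b k =
    if≢0 (walks k x a) (if≢0 (earlyWalks x b k) 0 (if≢0 (rivalWalks x a b k) 0 1)) 0

  critical : ℕ → ℕ → ℕ → ℕ
  critical x a b = sum {n} λ k → criticalAt x a b (toℕ k)

  -- Shortest walks from `x` may traverse the edge in either direction.
  monitors : ℕ → ℕ → ℕ → ℕ
  monitors x a b = critical x a b + critical x b a

module Reflection (G : Graph) (edge : ℕ → ℕ → ℕ)
  (edge⇒adj : ∀ u v → edge (toℕ u) (toℕ v) ≢ 0 → Adj G u v)
  (adj⇒edge : ∀ u v → Adj G u v → edge (toℕ u) (toℕ v) ≢ 0) where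

  open Numeric (order G) edge public

  walks⇒ : ∀ k x y → walks k (toℕ x) (toℕ y) ≢ 0 → Walk G x y k
  walks⇒ zero x y ne with refl ← toℕ-injective (equal⇒≡ (toℕ x) (toℕ y) ne) = nil
  walks⇒ (suc k) x y ne with sum≢0⇒ (λ z → if≢0 (walks k (toℕ x) (toℕ z)) (edge (toℕ z) (toℕ y)) 0) ne
  ... | z , ne′ with p , q ← and⇒ (walks k (toℕ x) (toℕ z)) ne′ =
    snoc (walks⇒ k x z p) (edge⇒adj z y q)

  ⇒walks : ∀ k x y → Walk G x y k → walks k (toℕ x) (toℕ y) ≢ 0
  ⇒walks zero x .x nil = equal-refl (toℕ x)
  ⇒walks (suc k) x y w with z , v , e ← unsnoc w =
    ⇒sum≢0 (λ z → if≢0 (walks k (toℕ x) (toℕ z)) (edge (toℕ z) (toℕ y)) 0) z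
      (⇒and (walks k (toℕ x) (toℕ z)) (⇒walks k x z v) (adj⇒edge z y e))

  earlyWalks≡0⇒ : ∀ x b k → k < order G → earlyWalks (toℕ x) (toℕ b) k ≡ 0 →
                  ∀ j → j ≤ k → ¬ Walk G x b j
  earlyWalks≡0⇒ x b k k<n none j j≤k w = ⇒and (suc k ∸ toℕ i)
    (λ eq → ℕ.<⇒≱ (s≤s j≤k) (ℕ.≤-trans (ℕ.m∸n≡0⇒m≤n eq) (ℕ.≤-reflexive i≡j)))
    (subst (λ l → walks l (toℕ x) (toℕ b) ≢ 0) (sym i≡j) (⇒walks j x b w))
    (sum≡0⇒ (λ j → if≢0 (suc k ∸ toℕ j) (walks (toℕ j) (toℕ x) (toℕ b)) 0) none i)
    where
    i = fromℕ< (ℕ.≤-<-trans j≤k k<n)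
    i≡j = toℕ-fromℕ< (ℕ.≤-<-trans j≤k k<n)

  ⇒earlyWalks≡0 : ∀ x b k → (∀ j → j ≤ k → ¬ Walk G x b j) → earlyWalks (toℕ x) (toℕ b) k ≡ 0
  ⇒earlyWalks≡0 x b k far = ⇒sum≡0 {order G} _ λ j → decidable-stable (_ ℕ.≟ 0) λ ne →
    let p , q = and⇒ (suc k ∸ toℕ j) ne in
    far (toℕ j) (ℕ.≮⇒≥ (λ k<j → p (ℕ.m≤n⇒m∸n≡0 k<j))) (walks⇒ (toℕ j) x b q)

  rivalWalks≡0⇒ : ∀ x a b k → rivalWalks (toℕ x) (toℕ a) (toℕ b) k ≡ 0 →
                  ∀ a′ → Adj G a′ b → Walk G x a′ k → a′ ≡ a
  rivalWalks≡0⇒ x a b k none a′ e w = toℕ-injective (equal⇒≡ (toℕ a′) (toℕ a) λ differ →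
    ⇒and (edge (toℕ a′) (toℕ b)) (adj⇒edge a′ b e)
      (⇒unless (equal (toℕ a′) (toℕ a)) differ (⇒walks k x a′ w))
      (sum≡0⇒ (λ a′ → if≢0 (edge (toℕ a′) (toℕ b))
        (if≢0 (equal (toℕ a′) (toℕ a)) 0 (walks k (toℕ x) (toℕ a′))) 0) none a′))

  ⇒rivalWalks≡0 : ∀ x a b k → (∀ a′ → Adj G a′ b → Walk G x a′ k → a′ ≡ a) →
                  rivalWalks (toℕ x) (toℕ a) (toℕ b) k ≡ 0
  ⇒rivalWalks≡0 x a b k unique = ⇒sum≡0 {order G} _ λ a′ → decidable-stable (_ ℕ.≟ 0) λ ne →
    let p , q = and⇒ (edge (toℕ a′) (toℕ b)) ne
        r , s = unless⇒ (equal (toℕ a′) (toℕ a)) q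
    in subst (λ z → equal (toℕ z) (toℕ a) ≢ 0) (sym (unique a′ (edge⇒adj a′ b p) (walks⇒ k x a′ s)))
         (equal-refl (toℕ a)) r

  critical⇒ : ∀ x a b → critical (toℕ x) (toℕ a) (toℕ b) ≢ 0 → Critical {G} x a b
  critical⇒ x a b ne with sum≢0⇒ (λ k → criticalAt (toℕ x) (toℕ a) (toℕ b) (toℕ k)) ne
  ... | k , ne₁ with w , ne₂ ← and⇒ (walks (toℕ k) (toℕ x) (toℕ a)) ne₁
    with far , ne₃ ← unless⇒ (earlyWalks (toℕ x) (toℕ b) (toℕ k)) ne₂
    with unique , _ ← unless⇒ (rivalWalks (toℕ x) (toℕ a) (toℕ b) (toℕ k)) ne₃ =
    toℕ k , walks⇒ (toℕ k) x a w , earlyWalks≡0⇒ x b (toℕ k) (toℕ<n k) far ,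
    rivalWalks≡0⇒ x a b (toℕ k) unique

  -- The witness `k` is the distance from `x` to `a`, hence less than the order and within the range
  -- of the sum.
  ⇒critical : ∀ {x a b} → Adj G a b → Critical {G} x a b → critical (toℕ x) (toℕ a) (toℕ b) ≢ 0
  ⇒critical {x} {a} {b} e (k , w , far , unique) =
    ⇒sum≢0 (λ k → criticalAt (toℕ x) (toℕ a) (toℕ b) (toℕ k)) (fromℕ< k<n)
      (subst (λ i → criticalAt (toℕ x) (toℕ a) (toℕ b) i ≢ 0) (sym (toℕ-fromℕ< k<n))
        (⇒and (walks k (toℕ x) (toℕ a)) (⇒walks k x a w)
          (⇒unless (earlyWalks (toℕ x) (toℕ b) k) (⇒earlyWalks≡0 x b k far)
            (⇒unless (rivalWalks (toℕ x) (toℕ a) (toℕ b) k) (⇒rivalWalks≡0 x a b k unique) λ ()))))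
    where
    k<n = distance<order (critical⇒distance e w far)

  monitors⇒ : ∀ {x a b} → Adj G a b → monitors (toℕ x) (toℕ a) (toℕ b) ≢ 0 → Monitors G x a b
  monitors⇒ {x} {a} {b} e ne with critical (toℕ x) (toℕ a) (toℕ b) ℕ.≟ 0
  ... | no  ≢0 = critical⇒monitors e (deleted {G} {a} {b} {a} {b} (sameEdge-refl {G} a b)) (critical⇒ x a b ≢0)
  ... | yes ≡0 = critical⇒monitors (adj-swap {G} e) (deleted {G} {a} {b} {b} {a} (sameEdge-swap {G} a b))
    (critical⇒ x b a (λ ≡0′ → ne (cong₂ _+_ ≡0 ≡0′)))

  ⇒monitors : ∀ {x a b} → Adj G a b → Monitors G x a b → monitors (toℕ x) (toℕ a) (toℕ b) ≢ 0
  ⇒monitors {x} {a} {b} e m eq = ¬critical⇒¬monitors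
    (λ c → ⇒critical e c (ℕ.m+n≡0⇒m≡0 _ eq))
    (λ c → ⇒critical (adj-swap {G} e) c (ℕ.m+n≡0⇒n≡0 (critical (toℕ x) (toℕ a) (toℕ b)) eq)) m

  monitors-self : ∀ {a b} → Adj G a b → monitors (toℕ a) (toℕ a) (toℕ b) ≢ 0
  monitors-self {a} e eq = ⇒critical e (critical-self e) (ℕ.m+n≡0⇒m≡0 _ eq)

-- The program

if≢0-cong : ∀ {c c′ t t′ u u′ : ℕ} → c ≡ c′ → t ≡ t′ → u ≡ u′ → if≢0 c t u ≡ if≢0 c′ t′ u′
if≢0-cong refl refl refl = refl

-- Array 0 holds the adjacency matrix, array 1 the chosen vertices, array 2
-- which walks exist, array 3 the monitoring relation, and cell 0 of array 4
-- the best candidate so far.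

edgeTerm : ∀ {d} → Fin d → Fin d → Term d
edgeTerm u v = get 0 (cell₂ (at u) (at v))

equalTerm : ∀ {d} → Fin d → Fin d → Term d
equalTerm x y = num 1 ⊟ ((at x ⊟ at y) ⊞ (at y ⊟ at x))

walksTerm : ∀ {d} → Fin d → Fin d → Fin d → Term d
walksTerm k x y = get 2 (cell₃ (at k) (at x) (at y))

-- For k = 0 the truncated predecessor is 0 again, and the first branch reads cells that may not be
-- filled yet; its value is then discarded.
nextWalksTerm : Term 3
nextWalksTerm =
  cond (at k)
    (∑ (cond (get 2 (cell₃ (at (suc k) ⊟ num 1) (at (suc x)) (at zero))) (edgeTerm zero (suc y)) (num 0)))
    (equalTerm x y)
  where
  y x k : Fin 3
  y = zero
  x = suc zero
  k = suc (suc zero)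

criticalTerm : ∀ {d} → Fin d → Fin d → Fin d → Term d
criticalTerm x a b =
  ∑ (cond (walksTerm zero (suc x) (suc a))
      (cond (∑ (cond ((num 1 ⊞ at (suc zero)) ⊟ at zero) (walksTerm zero (suc (suc x)) (suc (suc b))) (num 0)))
        (num 0)
        (cond (∑ (cond (edgeTerm zero (suc (suc b)))
                   (cond (equalTerm zero (suc (suc a))) (num 0) (walksTerm (suc zero) (suc (suc x)) zero))
                   (num 0)))
          (num 0)
          (num 1)))
      (num 0))

monitorsTerm : Term 3
monitorsTerm = criticalTerm x a b ⊞ criticalTerm x b a
  where
  b a x : Fin 3
  b = zero
  a = suc zero
  x = suc (suc zero)

relationTerm : ∀ {d} → Fin d → Fin d → Fin d → Term d
relationTerm x a b = get 3 (cell₃ (at x) (at a) (at b))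

coveredTerm : ∀ {d} → Fin d → Fin d → Term d
coveredTerm a b = ∑ (cond (get 1 (at zero)) (relationTerm zero (suc a) (suc b)) (num 0))

freshTerm : ∀ {d} → Fin d → Fin d → Term d
freshTerm a b =
  cond (at b ⊟ at a) (cond (edgeTerm a b) (cond (coveredTerm a b) (num 0) (num 1)) (num 0)) (num 0)

gainTerm : ∀ {d} → Fin d → Term d
gainTerm x = ∑ (∑ (cond (freshTerm (suc zero) zero)
  (cond (relationTerm (suc (suc x)) (suc zero) zero) (num 1) (num 0)) (num 0)))

best : ∀ {d} → Term d
best = get 4 (num 0)

-- The scan starts from the candidate left by the previous pass and replaces it only by a strictly
-- better vertex. All that is asked of the starting candidate is that it be a vertex.
compareBest : ∀ {d} → Command (suc d)
compareBest = put 4 (num 0)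
  (bind best (cond (gainTerm (suc zero) ⊟ gainTerm zero) (at (suc zero)) (at zero)))

-- Adding the gain to the cell marks the vertex exactly when the gain is positive, or keeps an
-- earlier mark. Once everything is covered, a pass changes nothing.
takeBest : ∀ {d} → Command d
takeBest = put 1 best (bind best (get 1 (at zero) ⊞ gainTerm zero))

-- Two outer loops make n² passes. This is enough, since there are at most n² edges and each pass
-- covers a new one while any is uncovered.
greedy : ∀ {d} → Command d
greedy = loop (loop (loop compareBest ﹔ takeBest))

algorithm : Command 0
algorithm = fill 2 nextWalksTerm ﹔ (fill 3 monitorsTerm ﹔ greedy)

module Coverage (n : ℕ) (edge : ℕ → ℕ → ℕ) (monitors : ℕ → ℕ → ℕ → ℕ) where

  covered : (ℕ → ℕ) → ℕ → ℕ → ℕ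
  covered M a b = sum {n} λ x → if≢0 (M (toℕ x)) (monitors (toℕ x) a b) 0

  -- The test `b ∸ a` admits only a < b, so each edge counts once, as in `edges`.
  fresh : (ℕ → ℕ) → ℕ → ℕ → ℕ
  fresh M a b = if≢0 (b ∸ a) (if≢0 (edge a b) (if≢0 (covered M a b) 0 1) 0) 0

  newly : (ℕ → ℕ) → ℕ → ℕ → ℕ → ℕ
  newly M x a b = if≢0 (fresh M a b) (if≢0 (monitors x a b) 1 0) 0

  gain : (ℕ → ℕ) → ℕ → ℕ
  gain M x = sum {n} λ a → sum {n} λ b → newly M x (toℕ a) (toℕ b)

-- Values of the program's terms

module _ (n : ℕ) (A : Arrays) where

  edge : ℕ → ℕ → ℕ
  edge u v = A 0 (n * u + v)

  open Numeric n edge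

  module _ {B : Arrays} (B₀ : B 0 ≡ A 0) where

    eval-edge : ∀ {d} (e : Vec ℕ d) u v → eval n B e (edgeTerm u v) ≡ edge (lookup e u) (lookup e v)
    eval-edge e u v = cong₂ (λ (M : ℕ → ℕ) → M) B₀ (eval-cell₂ n B e (at u) (at v))

    module _ (B₂ : ∀ {k x y} → k < n → x < n → y < n → B 2 (position n k x y) ≡ walks k x y) where

      eval-walks : ∀ {d} (e : Vec ℕ d) k x y → lookup e k < n → lookup e x < n → lookup e y < n →
                   eval n B e (walksTerm k x y) ≡ walks (lookup e k) (lookup e x) (lookup e y)
      eval-walks e k x y k<n x<n y<n =
        trans (cong (B 2) (eval-cell₃ n B e (at k) (at x) (at y))) (B₂ k<n x<n y<n)

      eval-critical : ∀ {d} (e : Vec ℕ d) x a b → lookup e x < n → lookup e a < n → lookup e b < n →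
                      eval n B e (criticalTerm x a b) ≡ critical (lookup e x) (lookup e a) (lookup e b)
      eval-critical e x a b x<n a<n b<n = sum-cong-≗ {n} λ k →
        if≢0-cong (eval-walks (toℕ k ∷ e) zero (suc x) (suc a) (toℕ<n k) x<n a<n)
          (if≢0-cong
            (sum-cong-≗ {n} λ j → if≢0-cong {suc (toℕ k) ∸ toℕ j} refl
              (eval-walks (toℕ j ∷ toℕ k ∷ e) zero (suc (suc x)) (suc (suc b)) (toℕ<n j) x<n b<n) refl)
            refl
            (if≢0-cong
              (sum-cong-≗ {n} λ a′ → if≢0-cong
                (eval-edge (toℕ a′ ∷ toℕ k ∷ e) zero (suc (suc b)))
                (if≢0-cong {equal (toℕ a′) (lookup e a)} refl refl
                  (eval-walks (toℕ a′ ∷ toℕ k ∷ e) (suc zero) (suc (suc x)) zero (toℕ<n k) x<n (toℕ<n a′)))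
                refl)
              refl refl))
          refl

    eval-nextWalks : ∀ {k x y} → k < n → x < n → y < n →
      (∀ {k′ x′ y′} → k′ < k → x′ < n → y′ < n → B 2 (position n k′ x′ y′) ≡ walks k′ x′ y′) →
      eval n B (y ∷ x ∷ k ∷ []) nextWalksTerm ≡ walks k x y
    eval-nextWalks {zero}  {x} {y} k<n x<n y<n B₂ = refl
    eval-nextWalks {suc k} {x} {y} k<n x<n y<n B₂ = sum-cong-≗ {n} λ z → if≢0-cong
      (trans (cong (B 2) (eval-cell₃ n B (toℕ z ∷ y ∷ x ∷ suc k ∷ []) (at (suc (suc (suc zero))) ⊟ num 1)
                           (at (suc (suc zero))) (at zero)))
             (B₂ ℕ.≤-refl x<n (toℕ<n z)))
      (eval-edge (toℕ z ∷ y ∷ x ∷ suc k ∷ []) zero (suc zero)) refl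

    module _ (B₃ : ∀ {x a b} → x < n → a < n → b < n → B 3 (position n x a b) ≡ monitors x a b) where

      open Coverage n edge monitors

      eval-relation : ∀ {d} (e : Vec ℕ d) x a b → lookup e x < n → lookup e a < n → lookup e b < n →
                      eval n B e (relationTerm x a b) ≡ monitors (lookup e x) (lookup e a) (lookup e b)
      eval-relation e x a b x<n a<n b<n =
        trans (cong (B 3) (eval-cell₃ n B e (at x) (at a) (at b))) (B₃ x<n a<n b<n)

      eval-fresh : ∀ {d} (e : Vec ℕ d) a b → lookup e a < n → lookup e b < n →
                   eval n B e (freshTerm a b) ≡ fresh (B 1) (lookup e a) (lookup e b)
      eval-fresh e a b a<n b<n = if≢0-cong {lookup e b ∸ lookup e a} refl
        (if≢0-cong (eval-edge e a b)
          (if≢0-cong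
            (sum-cong-≗ {n} λ x → if≢0-cong {B 1 (toℕ x)} refl
              (eval-relation (toℕ x ∷ e) zero (suc a) (suc b) (toℕ<n x) a<n b<n) refl)
            refl refl)
          refl)
        refl

      eval-gain : ∀ {d} (e : Vec ℕ d) x → lookup e x < n →
                  eval n B e (gainTerm x) ≡ gain (B 1) (lookup e x)
      eval-gain e x x<n = sum-cong-≗ {n} λ a → sum-cong-≗ {n} λ b → if≢0-cong
        (eval-fresh (toℕ b ∷ toℕ a ∷ e) (suc zero) zero (toℕ<n a) (toℕ<n b))
        (if≢0-cong (eval-relation (toℕ b ∷ toℕ a ∷ e) (suc (suc x)) (suc zero) zero x<n (toℕ<n a) (toℕ<n b))
          refl refl)
        refl

-- Bounds on the exponential

fromℕ-+ : ∀ m n → fromℕ (m + n) ≡ fromℕ m ℚ.+ fromℕ n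
fromℕ-+ m n = ℚ.toℚᵘ-injective (begin-equality
  toℚᵘ (fromℕ (m + n))                ≃⟨ ℚ.toℚᵘ-fromℚᵘ (mkℚᵘ (ℤ.+ (m + n)) 0) ⟩
  mkℚᵘ (ℤ.+ (m + n)) 0                  ≃⟨ *≡* (cong (ℤ._* ℤ.+ 1) (cong₂ ℤ._+_
                                           (ℤ.*-identityʳ (ℤ.+ m)) (ℤ.*-identityʳ (ℤ.+ n)))) ⟨
  mkℚᵘ (ℤ.+ m) 0 ℚᵘ.+ mkℚᵘ (ℤ.+ n) 0      ≃⟨ ℚᵘ.+-cong (ℚ.toℚᵘ-fromℚᵘ (mkℚᵘ (ℤ.+ m) 0))
                                                    (ℚ.toℚᵘ-fromℚᵘ (mkℚᵘ (ℤ.+ n) 0)) ⟨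
  toℚᵘ (fromℕ m) ℚᵘ.+ toℚᵘ (fromℕ n)  ≃⟨ ℚ.toℚᵘ-homo-+ (fromℕ m) (fromℕ n) ⟨
  toℚᵘ (fromℕ m ℚ.+ fromℕ n)          ∎)
  where open ℚᵘ.≤-Reasoning

fromℕ-* : ∀ m n → fromℕ (m * n) ≡ fromℕ m ℚ.* fromℕ n
fromℕ-* zero    n = sym (ℚ.*-zeroˡ (fromℕ n))
fromℕ-* (suc m) n = begin
  fromℕ (n + m * n)                      ≡⟨ fromℕ-+ n (m * n) ⟩
  fromℕ n ℚ.+ fromℕ (m * n)              ≡⟨ cong₂ ℚ._+_ (sym (ℚ.*-identityˡ (fromℕ n))) (fromℕ-* m n) ⟩
  1ℚ ℚ.* fromℕ n ℚ.+ fromℕ m ℚ.* fromℕ n ≡⟨ ℚ.*-distribʳ-+ (fromℕ n) 1ℚ (fromℕ m) ⟨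
  (1ℚ ℚ.+ fromℕ m) ℚ.* fromℕ n           ≡⟨ cong (ℚ._* fromℕ n) (fromℕ-+ 1 m) ⟨
  fromℕ (suc m) ℚ.* fromℕ n              ∎
  where open ≡-Reasoning

1/suc : ℕ → ℚ
1/suc n = ℤ.+ 1 ℚ./ suc n

suc*1/suc : ∀ n → fromℕ (suc n) ℚ.* 1/suc n ≡ 1ℚ
suc*1/suc n = ℚ.toℚᵘ-injective (begin-equality
  toℚᵘ (fromℕ (suc n) ℚ.* 1/suc n)          ≃⟨ ℚ.toℚᵘ-homo-* (fromℕ (suc n)) (1/suc n) ⟩
  toℚᵘ (fromℕ (suc n)) ℚᵘ.* toℚᵘ (1/suc n)  ≃⟨ ℚᵘ.*-cong (ℚ.toℚᵘ-fromℚᵘ (mkℚᵘ (ℤ.+ suc n) 0))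
                                                        (ℚ.toℚᵘ-fromℚᵘ (mkℚᵘ (ℤ.+ 1) n)) ⟩
  mkℚᵘ (ℤ.+ suc n) 0 ℚᵘ.* mkℚᵘ (ℤ.+ 1) n        ≃⟨ *≡* (cross n) ⟩
  toℚᵘ 1ℚ                                   ∎)
  where
  open ℚᵘ.≤-Reasoning
  cross : ∀ n → (ℤ.+ suc n ℤ.* ℤ.+ 1) ℤ.* ℤ.+ 1 ≡ ℤ.+ 1 ℤ.* ℤ.+ suc (n + 0)
  cross n = trans (ℤ.*-identityʳ _) (trans (ℤ.*-identityʳ _)
    (trans (cong (λ m → ℤ.+ suc m) (sym (ℕ.+-identityʳ n))) (sym (ℤ.*-identityˡ _))))

Nonneg : ℚ → Set
Nonneg p = 0ℚ ℚ.≤ p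

fromℕ-nonneg : ∀ n → Nonneg (fromℕ n)
fromℕ-nonneg n = ℚ.nonNegative⁻¹ (fromℕ n) {{ℚ.normalize-nonNeg n 1}}

1/suc-nonneg : ∀ n → Nonneg (1/suc n)
1/suc-nonneg n = ℚ.nonNegative⁻¹ (1/suc n) {{ℚ.normalize-nonNeg 1 (suc n)}}

+-nonneg : ∀ {p q} → Nonneg p → Nonneg q → Nonneg (p ℚ.+ q)
+-nonneg = ℚ.+-mono-≤

*-nonneg : ∀ {p q} → Nonneg p → Nonneg q → Nonneg (p ℚ.* q)
*-nonneg {p} {q} 0≤p 0≤q =
  subst (ℚ._≤ p ℚ.* q) (ℚ.*-zeroʳ p) (ℚ.*-monoˡ-≤-nonNeg p {{ℚ.nonNegative 0≤p}} 0≤q)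

≤⇒0≤- : ∀ {p q} → p ℚ.≤ q → Nonneg (q ℚ.- p)
≤⇒0≤- {p} {q} p≤q = subst (ℚ._≤ q ℚ.- p) (ℚ.+-inverseʳ p) (ℚ.+-monoˡ-≤ (ℚ.- p) p≤q)

0≤-⇒≤ : ∀ {p q} → Nonneg (q ℚ.- p) → p ℚ.≤ q
0≤-⇒≤ {p} {q} 0≤q-p = subst₂ ℚ._≤_ (ℚ.+-identityˡ p)
  (solve 2 (λ p q → q :- p :+ p := q) refl p q) (ℚ.+-monoˡ-≤ p 0≤q-p)
  where open ℚ-Solver

fromℕ-mono : ∀ {m n} → m ≤ n → fromℕ m ℚ.≤ fromℕ n
fromℕ-mono {m} {n} m≤n = begin
  fromℕ m                      ≡⟨ ℚ.+-identityʳ (fromℕ m) ⟨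
  fromℕ m ℚ.+ 0ℚ               ≤⟨ ℚ.+-monoʳ-≤ (fromℕ m) (fromℕ-nonneg (n ∸ m)) ⟩
  fromℕ m ℚ.+ fromℕ (n ∸ m)    ≡⟨ fromℕ-+ m (n ∸ m) ⟨
  fromℕ (m + (n ∸ m))          ≡⟨ cong fromℕ (ℕ.m+[n∸m]≡n m≤n) ⟩
  fromℕ n                      ∎
  where open ℚ.≤-Reasoning

expTerm-nonneg : ∀ {q} → Nonneg q → ∀ k → Nonneg (expTerm q k)
expTerm-nonneg 0≤q zero    = fromℕ-nonneg 1
expTerm-nonneg 0≤q (suc k) = *-nonneg (*-nonneg (expTerm-nonneg 0≤q k) 0≤q) (1/suc-nonneg k)

expTerm-mono : ∀ {p h} → Nonneg p → Nonneg h → ∀ k → expTerm p k ℚ.≤ expTerm (p ℚ.+ h) k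
expTerm-mono 0≤p 0≤h zero = ℚ.≤-refl
expTerm-mono {p} {h} 0≤p 0≤h (suc k) =
  0≤-⇒≤ (subst Nonneg
    (solve 5 (λ p h t s i → (s :- t) :* p :* i :+ s :* h :* i
                         := s :* (p :+ h) :* i :- t :* p :* i) refl p h t s i)
    (+-nonneg (*-nonneg (*-nonneg (≤⇒0≤- (expTerm-mono 0≤p 0≤h k)) 0≤p) 0≤i)
              (*-nonneg (*-nonneg (expTerm-nonneg (+-nonneg 0≤p 0≤h) k) 0≤h) 0≤i)))
  where
  open ℚ-Solver
  t = expTerm p k
  s = expTerm (p ℚ.+ h) k
  i = 1/suc k
  0≤i = 1/suc-nonneg k

-- The trapezoidal rule overestimates the integral of the convex function
-- z^k / k! from x to x + h.
expTerm-trapezoid : ∀ {x h} → Nonneg x → Nonneg h → ∀ k →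
  Nonneg (h ℚ.* (expTerm (x ℚ.+ h) k ℚ.+ expTerm x k) ℚ.+
          (expTerm x (suc k) ℚ.+ expTerm x (suc k)) ℚ.-
          (expTerm (x ℚ.+ h) (suc k) ℚ.+ expTerm (x ℚ.+ h) (suc k)))
expTerm-trapezoid {x} {h} 0≤x 0≤h zero = ℚ.≤-reflexive
  (solve 2 (λ x h → con 0ℚ := h :* (con 1ℚ :+ con 1ℚ) :+
                       (con 1ℚ :* x :* con 1ℚ :+ con 1ℚ :* x :* con 1ℚ) :-
                       (con 1ℚ :* (x :+ h) :* con 1ℚ :+ con 1ℚ :* (x :+ h) :* con 1ℚ)) refl x h)
  where open ℚ-Solver
-- With i = 1 / (k + 2), the error for exponent k + 1 equals i / 2 times the sum of (2x + h) times
-- the error for exponent k and h² (ty - tx). Both summands are nonnegative, the second by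
-- monotonicity.
expTerm-trapezoid {x} {h} 0≤x 0≤h (suc k) = subst Nonneg eq
  (*-nonneg (*-nonneg (½-nonneg) (1/suc-nonneg (suc k)))
    (+-nonneg (*-nonneg (+-nonneg (+-nonneg 0≤x 0≤x) 0≤h) (expTerm-trapezoid 0≤x 0≤h k))
              (*-nonneg (*-nonneg 0≤h 0≤h) (≤⇒0≤- (expTerm-mono 0≤x 0≤h k)))))
  where
  ½-nonneg : Nonneg ½
  ½-nonneg = ℚ.nonNegative⁻¹ ½
  y  = x ℚ.+ h
  ty = expTerm y k
  tx = expTerm x k
  Ty = expTerm y (suc k)
  Tx = expTerm x (suc k)
  i  = 1/suc (suc k)
  s  = fromℕ (suc k)
  I  = h ℚ.* (ty ℚ.+ tx) ℚ.+ (Tx ℚ.+ Tx) ℚ.- (Ty ℚ.+ Ty)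
  s*T : ∀ z → expTerm z k ℚ.* z ≡ s ℚ.* expTerm z (suc k)
  s*T z = begin
    t ℚ.* z                      ≡⟨ ℚ.*-identityˡ (t ℚ.* z) ⟨
    1ℚ ℚ.* (t ℚ.* z)             ≡⟨ cong (ℚ._* (t ℚ.* z)) (suc*1/suc k) ⟨
    s ℚ.* j ℚ.* (t ℚ.* z)        ≡⟨ solve 4 (λ s j t z → s :* j :* (t :* z) := s :* (t :* z :* j)) refl s j t z ⟩
    s ℚ.* (t ℚ.* z ℚ.* j)        ∎
    where
    open ≡-Reasoning
    open ℚ-Solver
    t = expTerm z k
    j = 1/suc k
  eq : ½ ℚ.* i ℚ.* ((x ℚ.+ x ℚ.+ h) ℚ.* I ℚ.+ h ℚ.* h ℚ.* (ty ℚ.- tx)) ≡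
       h ℚ.* (Ty ℚ.+ Tx) ℚ.+ (Tx ℚ.* x ℚ.* i ℚ.+ Tx ℚ.* x ℚ.* i) ℚ.-
         (Ty ℚ.* y ℚ.* i ℚ.+ Ty ℚ.* y ℚ.* i)
  eq = begin
    ½ ℚ.* i ℚ.* ((x ℚ.+ x ℚ.+ h) ℚ.* I ℚ.+ h ℚ.* h ℚ.* (ty ℚ.- tx))
      ≡⟨ solve 7 (λ x h ty tx Ty Tx i →
           con ½ :* i :* ((x :+ x :+ h) :* (h :* (ty :+ tx) :+ (Tx :+ Tx) :- (Ty :+ Ty))
             :+ h :* h :* (ty :- tx))
           := (x :+ x :+ h) :* i :* (Tx :- Ty) :+ h :* i :* (ty :* (x :+ h) :+ tx :* x))
           refl x h ty tx Ty Tx i ⟩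
    (x ℚ.+ x ℚ.+ h) ℚ.* i ℚ.* (Tx ℚ.- Ty) ℚ.+ h ℚ.* i ℚ.* (ty ℚ.* y ℚ.+ tx ℚ.* x)
      ≡⟨ cong (λ z → (x ℚ.+ x ℚ.+ h) ℚ.* i ℚ.* (Tx ℚ.- Ty) ℚ.+ h ℚ.* i ℚ.* z)
              (cong₂ ℚ._+_ (s*T y) (s*T x)) ⟩
    (x ℚ.+ x ℚ.+ h) ℚ.* i ℚ.* (Tx ℚ.- Ty) ℚ.+ h ℚ.* i ℚ.* (s ℚ.* Ty ℚ.+ s ℚ.* Tx)
      ≡⟨ solve 6 (λ x h Ty Tx i s →
           (x :+ x :+ h) :* i :* (Tx :- Ty) :+ h :* i :* (s :* Ty :+ s :* Tx)
           := ((con 1ℚ :+ s) :* i) :* (h :* (Ty :+ Tx)) :+ (Tx :* x :* i :+ Tx :* x :* i)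
                :- (Ty :* (x :+ h) :* i :+ Ty :* (x :+ h) :* i))
           refl x h Ty Tx i s ⟩
    (1ℚ ℚ.+ s) ℚ.* i ℚ.* (h ℚ.* (Ty ℚ.+ Tx)) ℚ.+ (Tx ℚ.* x ℚ.* i ℚ.+ Tx ℚ.* x ℚ.* i) ℚ.-
      (Ty ℚ.* y ℚ.* i ℚ.+ Ty ℚ.* y ℚ.* i)
      ≡⟨ cong (λ z → z ℚ.+ (Tx ℚ.* x ℚ.* i ℚ.+ Tx ℚ.* x ℚ.* i) ℚ.- (Ty ℚ.* y ℚ.* i ℚ.+ Ty ℚ.* y ℚ.* i))
           (trans (cong (λ z → z ℚ.* i ℚ.* (h ℚ.* (Ty ℚ.+ Tx))) (sym (fromℕ-+ 1 (suc k))))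
             (trans (cong (ℚ._* (h ℚ.* (Ty ℚ.+ Tx))) (suc*1/suc (suc k))) (ℚ.*-identityˡ (h ℚ.* (Ty ℚ.+ Tx))))) ⟩
    h ℚ.* (Ty ℚ.+ Tx) ℚ.+ (Tx ℚ.* x ℚ.* i ℚ.+ Tx ℚ.* x ℚ.* i) ℚ.-
      (Ty ℚ.* y ℚ.* i ℚ.+ Ty ℚ.* y ℚ.* i) ∎
    where
    open ≡-Reasoning
    open ℚ-Solver

-- Integration raises degrees by one, so adding up the bounds for single terms compares `k` terms on
-- the side of the rule with `k + 1` terms of the integral (`shifted`). The missing term on the side
-- of the rule is nonnegative and can be added.
expSum-trapezoid : ∀ {x h} → Nonneg x → Nonneg h → ∀ k →
  Nonneg (h ℚ.* (expSum (x ℚ.+ h) k ℚ.+ expSum x k) ℚ.+ (expSum x k ℚ.+ expSum x k) ℚ.-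
          (expSum (x ℚ.+ h) k ℚ.+ expSum (x ℚ.+ h) k))
expSum-trapezoid {x} {h} 0≤x 0≤h zero = ℚ.≤-reflexive
  (solve 1 (λ h → con 0ℚ := h :* (con 0ℚ :+ con 0ℚ) :+ (con 0ℚ :+ con 0ℚ) :- (con 0ℚ :+ con 0ℚ)) refl h)
  where open ℚ-Solver
expSum-trapezoid {x} {h} 0≤x 0≤h (suc k) = subst Nonneg
  (solve 7 (λ h Sy Sx ty tx Sy′ Sx′ → h :* (Sy :+ Sx) :+ (Sx′ :+ Sx′) :- (Sy′ :+ Sy′) :+ h :* (ty :+ tx)
                        := h :* ((Sy :+ ty) :+ (Sx :+ tx)) :+ (Sx′ :+ Sx′) :- (Sy′ :+ Sy′))
    refl h (expSum y k) (expSum x k) (expTerm y k) (expTerm x k) (expSum y (suc k)) (expSum x (suc k)))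
  (+-nonneg (shifted k) (*-nonneg 0≤h (+-nonneg (expTerm-nonneg (+-nonneg 0≤x 0≤h) k) (expTerm-nonneg 0≤x k))))
  where
  open ℚ-Solver
  y = x ℚ.+ h
  shifted : ∀ k → Nonneg (h ℚ.* (expSum y k ℚ.+ expSum x k) ℚ.+
                          (expSum x (suc k) ℚ.+ expSum x (suc k)) ℚ.-
                          (expSum y (suc k) ℚ.+ expSum y (suc k)))
  shifted zero = ℚ.≤-reflexive
    (solve 1 (λ h → con 0ℚ := h :* (con 0ℚ :+ con 0ℚ) :+ (con 1ℚ :+ con 1ℚ) :- (con 1ℚ :+ con 1ℚ)) refl h)
  shifted (suc k) = subst Nonneg
    (solve 9 (λ h Sy Sx ty tx Sy′ Sx′ Ty Tx →
        (h :* (Sy :+ Sx) :+ (Sx′ :+ Sx′) :- (Sy′ :+ Sy′)) :+ (h :* (ty :+ tx) :+ (Tx :+ Tx) :- (Ty :+ Ty))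
        := h :* ((Sy :+ ty) :+ (Sx :+ tx)) :+ ((Sx′ :+ Tx) :+ (Sx′ :+ Tx)) :- ((Sy′ :+ Ty) :+ (Sy′ :+ Ty)))
      refl h (expSum y k) (expSum x k) (expTerm y k) (expTerm x k) (expSum y (suc k)) (expSum x (suc k))
        (expTerm y (suc k)) (expTerm x (suc k)))
    (+-nonneg (shifted k) (expTerm-trapezoid 0≤x 0≤h k))

_/suc_ : ℕ → ℕ → ℚ
m /suc k = fromℕ m ℚ.* 1/suc k

/suc-nonneg : ∀ m k → Nonneg (m /suc k)
/suc-nonneg m k = *-nonneg (fromℕ-nonneg m) (1/suc-nonneg k)

suc*/suc : ∀ m k → fromℕ (suc k) ℚ.* (m /suc k) ≡ fromℕ m
suc*/suc m k = begin
  κ ℚ.* (μ ℚ.* η)   ≡⟨ solve 3 (λ κ μ η → κ :* (μ :* η) := κ :* η :* μ) refl κ μ η ⟩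
  κ ℚ.* η ℚ.* μ     ≡⟨ cong (ℚ._* μ) (suc*1/suc k) ⟩
  1ℚ ℚ.* μ          ≡⟨ ℚ.*-identityˡ μ ⟩
  μ                 ∎
  where
  open ≡-Reasoning
  open ℚ-Solver
  κ = fromℕ (suc k)
  μ = fromℕ m
  η = 1/suc k

+-/suc : ∀ m n k → (m + n) /suc k ≡ m /suc k ℚ.+ n /suc k
+-/suc m n k = trans (cong (ℚ._* 1/suc k) (fromℕ-+ m n))
                     (ℚ.*-distribʳ-+ (1/suc k) (fromℕ m) (fromℕ n))

-- With K = `suc k`, the equation makes `suc w` equal to 2K - c and `suc w + (c + c)` equal to 2K +
-- c. The trapezoidal bound for h = c / K, multiplied by K, says (2K - c) exp ((m + c) / K) ≤ (2K +
-- c) exp (m / K) for partial sums. Writing 2K - c as a successor makes it positive, so that it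
-- cancels.
expSum-grow : ∀ k w c p b m j → suc w + c ≡ suc k + suc k →
              (suc w + (c + c)) * p ≤ suc w * b →
              expSum (m /suc k) j ℚ.≤ fromℕ p → expSum ((m + c) /suc k) j ℚ.≤ fromℕ b
expSum-grow k w c p b m j eq bound ih = ℚ.*-cancelˡ-≤-pos ω {{ℚ.normalize-pos (suc w) 1}} (begin
  ω ℚ.* expSum ((m + c) /suc k) j    ≡⟨ cong (λ z → ω ℚ.* expSum z j) (+-/suc m c k) ⟩
  ω ℚ.* Y                            ≤⟨ 0≤-⇒≤ (subst Nonneg scaled
                                          (*-nonneg (fromℕ-nonneg (suc k))
                                            (expSum-trapezoid (/suc-nonneg m k) (/suc-nonneg c k) j))) ⟩
  (ω ℚ.+ (γ ℚ.+ γ)) ℚ.* X            ≡⟨ cong (ℚ._* X) ω+2γ ⟨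
  fromℕ (suc w + (c + c)) ℚ.* X      ≤⟨ ℚ.*-monoˡ-≤-nonNeg (fromℕ (suc w + (c + c)))
                                          {{ℚ.nonNegative (fromℕ-nonneg (suc w + (c + c)))}} ih ⟩
  fromℕ (suc w + (c + c)) ℚ.* fromℕ p ≡⟨ fromℕ-* (suc w + (c + c)) p ⟨
  fromℕ ((suc w + (c + c)) * p)      ≤⟨ fromℕ-mono bound ⟩
  fromℕ (suc w * b)                  ≡⟨ fromℕ-* (suc w) b ⟩
  ω ℚ.* fromℕ b                      ∎)
  where
  open ℚ.≤-Reasoning
  open ℚ-Solver
  ω = fromℕ (suc w)
  γ = fromℕ c
  κ = fromℕ (suc k)
  h = c /suc k
  X = expSum (m /suc k) j
  Y = expSum (m /suc k ℚ.+ h) j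
  ω+2γ : fromℕ (suc w + (c + c)) ≡ ω ℚ.+ (γ ℚ.+ γ)
  ω+2γ = trans (fromℕ-+ (suc w) (c + c)) (cong (ω ℚ.+_) (fromℕ-+ c c))
  ω+γ : κ ℚ.+ κ ≡ ω ℚ.+ γ
  ω+γ = trans (sym (fromℕ-+ (suc k) (suc k))) (trans (cong fromℕ (sym eq)) (fromℕ-+ (suc w) c))
  scaled : κ ℚ.* (h ℚ.* (Y ℚ.+ X) ℚ.+ (X ℚ.+ X) ℚ.- (Y ℚ.+ Y)) ≡ (ω ℚ.+ (γ ℚ.+ γ)) ℚ.* X ℚ.- ω ℚ.* Y
  scaled = begin-equality
    κ ℚ.* (h ℚ.* (Y ℚ.+ X) ℚ.+ (X ℚ.+ X) ℚ.- (Y ℚ.+ Y))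
      ≡⟨ solve 4 (λ κ h X Y → κ :* (h :* (Y :+ X) :+ (X :+ X) :- (Y :+ Y))
                           := (κ :* h) :* (Y :+ X) :+ (κ :+ κ) :* (X :- Y)) refl κ h X Y ⟩
    (κ ℚ.* h) ℚ.* (Y ℚ.+ X) ℚ.+ (κ ℚ.+ κ) ℚ.* (X ℚ.- Y)
      ≡⟨ cong₂ (λ u v → u ℚ.* (Y ℚ.+ X) ℚ.+ v ℚ.* (X ℚ.- Y)) (suc*/suc c k) ω+γ ⟩
    γ ℚ.* (Y ℚ.+ X) ℚ.+ (ω ℚ.+ γ) ℚ.* (X ℚ.- Y)
      ≡⟨ solve 4 (λ γ ω X Y → γ :* (Y :+ X) :+ (ω :+ γ) :* (X :- Y)
                           := (ω :+ (γ :+ γ)) :* X :- ω :* Y) refl γ ω X Y ⟩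
    (ω ℚ.+ (γ ℚ.+ γ)) ℚ.* X ℚ.- ω ℚ.* Y ∎

expSum-zero : ∀ k j → expSum (0 /suc k) j ℚ.≤ fromℕ 1
expSum-zero k zero    = fromℕ-nonneg 1
expSum-zero k (suc j) = ℚ.≤-reflexive (go j)
  where
  go : ∀ j → expSum (0 /suc k) (suc j) ≡ 1ℚ
  go zero    = refl
  go (suc j) = begin
    expSum (0 /suc k) (suc j) ℚ.+ t ℚ.* (0ℚ ℚ.* η) ℚ.* 1/suc j
      ≡⟨ cong₂ ℚ._+_ (go j) (solve 3 (λ t η i → t :* (con 0ℚ :* η) :* i := con 0ℚ) refl t η (1/suc j)) ⟩
    1ℚ ℚ.+ 0ℚ   ≡⟨⟩
    1ℚ          ∎
    where
    open ≡-Reasoning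
    open ℚ-Solver
    t = expTerm (0 /suc k) j
    η = 1/suc k

-- The ratio of a greedy run

-- GreedyRun k u N: starting from u uncovered elements, N greedy choices
-- cover them all, when k sets suffice.
data GreedyRun (k : ℕ) : ℕ → ℕ → Set where
  done   : GreedyRun k 0 0
  -- As `c` is the largest possible gain, `k` sets covering all v + c elements force v + c ≤ c * k.
  choose : ∀ {v N} c → 0 < c → v + c ≤ c * k → GreedyRun k v N → GreedyRun k (v + c) (suc N)

choices≤uncovered : ∀ {k u N} → GreedyRun k u N → N ≤ u
choices≤uncovered done = z≤n
choices≤uncovered {N = suc N} (choose {v} c 0<c _ g) = begin
  suc N   ≡⟨ ℕ.+-comm 1 N ⟩
  N + 1   ≤⟨ ℕ.+-mono-≤ (choices≤uncovered g) 0<c ⟩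
  v + c   ∎
  where open ℕ.≤-Reasoning

-- This is where at least two sets in the optimum are needed.
expSum-few : ∀ k {N} j → N ≤ 2 + k → expSum (N /suc suc k) j ℚ.≤ fromℕ (suc N)
-- One trapezoidal step of width N / K from exp 0 = 1, where K = 2 + k and `suc w` is 2K - N.
expSum-few k {N} j N≤k = expSum-grow (suc k) w N 1 (suc N) 0 j eq bound (expSum-zero (suc k) j)
  where
  r = 2 + k ∸ N
  N+r : N + r ≡ 2 + k
  N+r = ℕ.m+[n∸m]≡n N≤k
  w = suc k + r
  open ℕ-Solver
  eq : suc w + N ≡ (2 + k) + (2 + k)
  eq = trans (solve 3 (λ k r N → con 2 :+ k :+ r :+ N := con 2 :+ k :+ (N :+ r)) refl k r N)
             (cong (λ m → 2 + k + m) N+r)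
  -- The difference of the two sides is (2K - N - 2) N, that is (k + r) N.
  bound : (suc w + (N + N)) * 1 ≤ suc w * suc N
  bound = begin
    (suc w + (N + N)) * 1                 ≤⟨ ℕ.m≤m+n _ ((k + r) * N) ⟩
    (suc w + (N + N)) * 1 + (k + r) * N   ≡⟨ solve 3 (λ k r N →
        (con 2 :+ k :+ r :+ (N :+ N)) :* con 1 :+ (k :+ r) :* N
          := (con 2 :+ k :+ r) :* (con 1 :+ N)) refl k r N ⟩
    suc w * suc N                         ∎
    where open ℕ.≤-Reasoning

-- With K = 2 + k, the ratio (v + c + 1) / (v + 1) of a greedy step is at least
-- (2K + 1) / (2K - 1) ≥ exp (1 / K) if c ≥ 2, and c ≥ 2 is automatic while more
-- than K elements are uncovered.
expSum-greedy : ∀ k {u N} → GreedyRun (2 + k) u N → ∀ j →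
                expSum (N /suc suc k) j ℚ.≤ fromℕ (suc u)
expSum-greedy k {u} {N} g j with u ℕ.≤? 2 + k
... | yes u≤k = ℚ.≤-trans (expSum-few k j (ℕ.≤-trans N≤u u≤k)) (fromℕ-mono (s≤s N≤u))
  where N≤u = choices≤uncovered g
expSum-greedy k done j | no u≰k = contradiction z≤n u≰k
expSum-greedy k (choose 1 _ u≤ck g) j | no u≰k =
  contradiction (ℕ.≤-trans u≤ck (ℕ.≤-reflexive (ℕ.*-identityˡ (2 + k)))) u≰k
expSum-greedy k (choose {v} {N} (suc (suc d)) _ u≤ck g) j | no u≰k =
  subst (λ z → expSum (z /suc suc k) j ℚ.≤ fromℕ (suc (v + c))) (ℕ.+-comm N 1)
    (expSum-grow (suc k) w 1 (suc v) (suc (v + c)) N j (solve 1 (λ k → con 3 :+ (k :+ k) :+ con 1 := con 2 :+ k :+ (con 2 :+ k)) refl k)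
      bound (expSum-greedy k g j))
  where
  c = 2 + d
  -- Chosen so that `suc w` is 2K - 1, for a step of width 1 / K.
  w = 2 + (k + k)
  open ℕ-Solver
  -- Twice the greedy bound is 2v + 2c ≤ 2Kc. Taking away c leaves 2v + c ≤ (2K - 1) c, and c ≥ 2
  -- finishes.
  2v+2≤wc : 2 + (v + v) ≤ suc w * c
  2v+2≤wc = ℕ.+-cancelʳ-≤ c _ _ (begin
    2 + (v + v) + c                ≤⟨ ℕ.m≤m+n _ d ⟩
    2 + (v + v) + c + d            ≡⟨ solve 2 (λ v d → con 2 :+ (v :+ v) :+ (con 2 :+ d) :+ d
                                        := (v :+ (con 2 :+ d)) :+ (v :+ (con 2 :+ d))) refl v d ⟩
    (v + c) + (v + c)              ≤⟨ ℕ.+-mono-≤ u≤ck u≤ck ⟩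
    c * (2 + k) + c * (2 + k)      ≡⟨ solve 2 (λ c k → c :* (con 2 :+ k) :+ c :* (con 2 :+ k)
                                        := (con 3 :+ (k :+ k)) :* c :+ c) refl c k ⟩
    suc w * c + c                  ∎)
    where open ℕ.≤-Reasoning
  bound : (suc w + 2) * suc v ≤ suc w * suc (v + c)
  bound = begin
    (suc w + 2) * suc v              ≡⟨ solve 2 (λ w v → (con 1 :+ w :+ con 2) :* (con 1 :+ v)
                                          := (con 1 :+ w) :* (con 1 :+ v) :+ (con 2 :+ (v :+ v))) refl w v ⟩
    suc w * suc v + (2 + (v + v))    ≤⟨ ℕ.+-monoʳ-≤ (suc w * suc v) 2v+2≤wc ⟩
    suc w * suc v + suc w * c        ≡⟨ ℕ.*-distribˡ-+ (suc w) (suc v) c ⟨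
    suc w * suc (v + c)              ∎
    where open ℕ.≤-Reasoning

greedy-ratio : ∀ k {u N} → GreedyRun k u N → N ≤ max1 (ln (suc u)) · k
greedy-ratio zero done = 1ℚ , inj₁ ℚ.≤-refl , ℚ.≤-refl
greedy-ratio zero (choose {v} c 0<c u≤ck g) = contradiction (begin
  1       ≤⟨ 0<c ⟩
  c       ≤⟨ ℕ.m≤n+m c v ⟩
  v + c   ≤⟨ u≤ck ⟩
  c * 0   ≡⟨ ℕ.*-zeroʳ c ⟩
  0       ∎) (λ ())
  where open ℕ.≤-Reasoning
greedy-ratio (suc zero) {u} {N} g = 1ℚ , inj₁ ℚ.≤-refl , fromℕ-mono (N≤1 g)
  where
  N≤1 : ∀ {u N} → GreedyRun 1 u N → N ≤ 1
  N≤1 done = z≤n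
  N≤1 (choose {v} c 0<c u≤c g) = s≤s (ℕ.≤-trans (choices≤uncovered g)
    (ℕ.+-cancelʳ-≤ c v 0 (ℕ.≤-trans u≤c (ℕ.≤-reflexive (ℕ.*-identityʳ c)))))
greedy-ratio (suc (suc k)) {u} {N} g =
  q , inj₂ (λ j → subst (λ z → expSum z j ℚ.≤ fromℕ (suc u)) (sym (ℚ.p≤q⇒p⊔q≡q (/suc-nonneg N (suc k))))
                    (expSum-greedy k g j)) ,
  ℚ.≤-reflexive (sym (trans (ℚ.*-comm q _) (suc*/suc N (suc k))))
  where q = N /suc suc k

-- Greedy covering

sum-mono : ∀ {n} {f g : Fin n → ℕ} → (∀ i → f i ≤ g i) → sum f ≤ sum g
sum-mono {zero}  f≤g = z≤n
sum-mono {suc n} f≤g = ℕ.+-mono-≤ (f≤g zero) (sum-mono (λ i → f≤g (suc i)))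

sum-one-larger : ∀ {n} {f g : Fin n → ℕ} i → f i ≤ suc (g i) → (∀ j → j ≢ i → f j ≤ g j) →
                 sum f ≤ suc (sum g)
sum-one-larger zero    fᵢ≤ f≤g = ℕ.+-mono-≤ fᵢ≤ (sum-mono (λ j → f≤g (suc j) λ ()))
sum-one-larger {f = f} {g} (suc i) fᵢ≤ f≤g = ℕ.≤-trans
  (ℕ.+-mono-≤ (f≤g zero λ ()) (sum-one-larger {f = λ j → f (suc j)} i fᵢ≤
    (λ j j≢i → f≤g (suc j) λ { refl → j≢i refl })))
  (ℕ.≤-reflexive (ℕ.+-suc (g zero) _))

indicator : Bool → ℕ
indicator b = if b then 1 else 0

∣∣≡sum : ∀ {n} (S : Subset n) → ∣ S ∣ ≡ sum (λ i → indicator (lookup S i))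
∣∣≡sum []          = refl
∣∣≡sum (true  ∷ S) = cong suc (∣∣≡sum S)
∣∣≡sum (false ∷ S) = ∣∣≡sum S

sum-*-indicator : ∀ {n} g (S : Subset n) → sum (λ i → if lookup S i then g else 0) ≡ g * ∣ S ∣
sum-*-indicator g []          = sym (ℕ.*-zeroʳ g)
sum-*-indicator g (true  ∷ S) = trans (cong (g +_) (sum-*-indicator g S)) (sym (ℕ.*-suc g ∣ S ∣))
sum-*-indicator g (false ∷ S) = sum-*-indicator g S

module CoverageProperties (n : ℕ) (edge : ℕ → ℕ → ℕ) (monitors : ℕ → ℕ → ℕ → ℕ)
  (monitors-self : ∀ (a b : Fin n) → edge (toℕ a) (toℕ b) ≢ 0 → monitors (toℕ a) (toℕ a) (toℕ b) ≢ 0)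
  where

  open Coverage n edge monitors public

  remaining : (ℕ → ℕ) → ℕ
  remaining M = sum {n} λ a → sum {n} λ b → fresh M (toℕ a) (toℕ b)

  chosen : (ℕ → ℕ) → ℕ
  chosen M = sum {n} λ x → if≢0 (M (toℕ x)) 1 0

  Covers : Subset n → Set
  Covers S = ∀ (a b : Fin n) → toℕ a < toℕ b → edge (toℕ a) (toℕ b) ≢ 0 →
             ∃[ x ] x ∈ S × monitors (toℕ x) (toℕ a) (toℕ b) ≢ 0

  module _ (M M′ : ℕ → ℕ) (M≗M′ : ∀ (x : Fin n) → M (toℕ x) ≡ M′ (toℕ x)) where

    chosen-cong : chosen M ≡ chosen M′
    chosen-cong = sum-cong-≗ {n} λ x → cong (λ m → if≢0 m 1 0) (M≗M′ x)

    remaining-cong : remaining M ≡ remaining M′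
    remaining-cong = sum-cong-≗ {n} λ a → sum-cong-≗ {n} λ b →
      cong (λ c → if≢0 (toℕ b ∸ toℕ a) (if≢0 (edge (toℕ a) (toℕ b)) (if≢0 c 0 1) 0) 0)
        (sum-cong-≗ {n} λ x → cong (λ m → if≢0 m (monitors (toℕ x) (toℕ a) (toℕ b)) 0) (M≗M′ x))

  module _ (M : ℕ → ℕ) (z : Fin n) {v : ℕ} (v≢0 : v ≢ 0) where

    private
      M′ = update (toℕ z) v M

      M′-other : ∀ {x : Fin n} → x ≢ z → M′ (toℕ x) ≡ M (toℕ x)
      M′-other x≢z = update-other M v (λ eq → x≢z (toℕ-injective eq))

    covered-new : ∀ a b → monitors (toℕ z) a b ≢ 0 → covered M′ a b ≢ 0
    covered-new a b m≢0 = ⇒sum≢0 (λ x → if≢0 (M′ (toℕ x)) (monitors (toℕ x) a b) 0) z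
      (⇒and (M′ (toℕ z)) (λ eq → v≢0 (trans (sym (update-same M v (toℕ z))) eq)) m≢0)

    covered-old : ∀ a b → covered M a b ≢ 0 → covered M′ a b ≢ 0
    covered-old a b c≢0
      with x , ne ← sum≢0⇒ (λ x → if≢0 (M (toℕ x)) (monitors (toℕ x) a b) 0) c≢0
      with p , q ← and⇒ (M (toℕ x)) ne with x ≟ z
    ... | yes refl = covered-new a b q
    ... | no  x≢z  = ⇒sum≢0 (λ x → if≢0 (M′ (toℕ x)) (monitors (toℕ x) a b) 0) x
      (⇒and (M′ (toℕ x)) (λ eq → p (trans (sym (M′-other x≢z)) eq)) q)

    uncovered : ∀ a b → covered M a b ≡ 0 → monitors (toℕ z) a b ≡ 0 → covered M′ a b ≡ 0
    uncovered a b c≡0 m≡0 = ⇒sum≡0 {n} _ λ x → term x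
      where
      term : ∀ x → if≢0 (M′ (toℕ x)) (monitors (toℕ x) a b) 0 ≡ 0
      term x with x ≟ z
      ... | yes refl = trans (if≢0-cong {M′ (toℕ z)} refl m≡0 refl) (if-0 (M′ (toℕ z)))
        where
        if-0 : ∀ c → if≢0 c 0 0 ≡ 0
        if-0 zero    = refl
        if-0 (suc c) = refl
      ... | no x≢z = trans (if≢0-cong (M′-other x≢z) refl refl)
        (sum≡0⇒ (λ x → if≢0 (M (toℕ x)) (monitors (toℕ x) a b) 0) c≡0 x)

    -- An uncovered edge either is newly covered by `z` or stays uncovered. Only zero against
    -- nonzero matters, so `split` runs through the patterns; its three implications rule out the
    -- impossible ones.
    fresh-update : ∀ a b → newly M (toℕ z) a b + fresh M′ a b ≡ fresh M a b
    fresh-update a b = split (b ∸ a) (edge a b) (covered M a b) (covered M′ a b) (monitors (toℕ z) a b)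
      (covered-old a b) (covered-new a b) (uncovered a b)
      where
      split : ∀ o e c c′ m → (c ≢ 0 → c′ ≢ 0) → (m ≢ 0 → c′ ≢ 0) → (c ≡ 0 → m ≡ 0 → c′ ≡ 0) →
              let new c = if≢0 o (if≢0 e (if≢0 c 0 1) 0) 0 in
              if≢0 (new c) (if≢0 m 1 0) 0 + new c′ ≡ new c
      split zero    e       c       c′       m       p q r = refl
      split (suc o) zero    c       c′       m       p q r = refl
      split (suc o) (suc e) (suc c) zero     m       p q r = contradiction refl (p λ ())
      split (suc o) (suc e) (suc c) (suc c′) m       p q r = refl
      split (suc o) (suc e) zero    zero     (suc m) p q r = contradiction refl (q λ ())
      split (suc o) (suc e) zero    (suc c′) (suc m) p q r = refl
      split (suc o) (suc e) zero    zero     zero    p q r = refl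
      split (suc o) (suc e) zero    (suc c′) zero    p q r with () ← r refl refl

    remaining-update : remaining M′ + gain M (toℕ z) ≡ remaining M
    remaining-update = begin
      remaining M′ + gain M (toℕ z)  ≡⟨ ℕ.+-comm (remaining M′) _ ⟩
      gain M (toℕ z) + remaining M′  ≡⟨ ∑-distrib-+ {n} _ _ ⟨
      sum {n} (λ a → sum {n} (λ b → newly M (toℕ z) (toℕ a) (toℕ b)) + sum {n} (λ b → fresh M′ (toℕ a) (toℕ b)))
        ≡⟨ (sum-cong-≗ {n} λ a → ∑-distrib-+ {n} _ _) ⟨
      sum {n} (λ a → sum {n} (λ b → newly M (toℕ z) (toℕ a) (toℕ b) + fresh M′ (toℕ a) (toℕ b)))
        ≡⟨ (sum-cong-≗ {n} λ a → sum-cong-≗ {n} λ b → fresh-update (toℕ a) (toℕ b)) ⟩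
      remaining M ∎
      where open ≡-Reasoning

    chosen-update : chosen M′ ≤ suc (chosen M)
    chosen-update = sum-one-larger {n} z (ℕ.≤-trans (at-most-1 (M′ (toℕ z))) (s≤s z≤n))
      (λ j j≢z → ℕ.≤-reflexive (cong (λ m → if≢0 m 1 0) (M′-other j≢z)))
      where
      at-most-1 : ∀ c → if≢0 c 1 0 ≤ 1
      at-most-1 zero    = z≤n
      at-most-1 (suc c) = s≤s z≤n

  fresh⇒ : ∀ M a b → fresh M a b ≢ 0 → b ∸ a ≢ 0 × edge a b ≢ 0
  fresh⇒ M a b ne with p , q ← and⇒ (b ∸ a) ne = p , proj₁ (and⇒ (edge a b) q)

  fresh≤1 : ∀ M a b → fresh M a b ≤ 1
  fresh≤1 M a b = bound (b ∸ a) (edge a b) (covered M a b)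
    where
    bound : ∀ o e c → if≢0 o (if≢0 e (if≢0 c 0 1) 0) 0 ≤ 1
    bound zero    e       c       = z≤n
    bound (suc o) zero    c       = z≤n
    bound (suc o) (suc e) zero    = s≤s z≤n
    bound (suc o) (suc e) (suc c) = z≤n

  -- Each uncovered edge is newly covered by a member of S.
  remaining≤ : ∀ M S g → Covers S → (∀ (x : Fin n) → gain M (toℕ x) ≤ g) → remaining M ≤ g * ∣ S ∣
  remaining≤ M S g covers gain≤g = begin
    remaining M
      ≤⟨ sum-mono {n} (λ a → sum-mono {n} (λ b → pointwise a b)) ⟩
    sum {n} (λ a → sum {n} (λ b → sum {n} (λ x → share x a b)))
      -- Double counting: the sum over members of `S` moves outside the sums over edges.
      ≡⟨ (sum-cong-≗ {n} λ a → ∑-comm {n} {n} (λ b x → share x a b)) ⟩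
    sum {n} (λ a → sum {n} (λ x → sum {n} (λ b → share x a b)))
      ≡⟨ ∑-comm {n} {n} (λ a x → sum {n} (λ b → share x a b)) ⟩
    sum {n} (λ x → sum {n} (λ a → sum {n} (λ b → share x a b)))
      ≤⟨ sum-mono {n} total ⟩
    sum {n} (λ x → if lookup S x then g else 0)
      ≡⟨ sum-*-indicator g S ⟩
    g * ∣ S ∣ ∎
    where
    open ℕ.≤-Reasoning
    share : Fin n → Fin n → Fin n → ℕ
    share x a b = if lookup S x then newly M (toℕ x) (toℕ a) (toℕ b) else 0
    pointwise : ∀ a b → fresh M (toℕ a) (toℕ b) ≤ sum {n} (λ x → share x a b)
    pointwise a b with fresh M (toℕ a) (toℕ b) ℕ.≟ 0
    ... | yes ≡0 = ℕ.≤-trans (ℕ.≤-reflexive ≡0) z≤n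
    ... | no  ≢0 with p , q ← fresh⇒ M (toℕ a) (toℕ b) ≢0
      with x , x∈S , m≢0 ← covers a b (ℕ.≰⇒> (λ b≤a → p (ℕ.m≤n⇒m∸n≡0 b≤a))) q =
      ℕ.≤-trans (fresh≤1 M (toℕ a) (toℕ b)) (ℕ.n≢0⇒n>0 (⇒sum≢0 (λ x → share x a b) x
        (subst (λ s → (if s then newly M (toℕ x) (toℕ a) (toℕ b) else 0) ≢ 0) (sym ([]=⇒lookup x∈S))
          (⇒and (fresh M (toℕ a) (toℕ b)) ≢0 (⇒and (monitors (toℕ x) (toℕ a) (toℕ b)) {1} m≢0 λ ())))))
    total : ∀ x → sum {n} (λ a → sum {n} (λ b → share x a b)) ≤ (if lookup S x then g else 0)
    total x with lookup S x
    ... | true  = gain≤g x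
    ... | false = ℕ.≤-reflexive (⇒sum≡0 {n} _ λ a → ⇒sum≡0 {n} _ λ b → refl)

  -- A vertex monitors its own edges, so any uncovered edge gives some vertex a gain.
  no-gain : ∀ M → (∀ (x : Fin n) → gain M (toℕ x) ≡ 0) → remaining M ≡ 0
  no-gain M gain≡0 = ⇒sum≡0 {n} _ λ a → ⇒sum≡0 {n} _ λ b → none a b
    where
    none : ∀ a b → fresh M (toℕ a) (toℕ b) ≡ 0
    none a b with fresh M (toℕ a) (toℕ b) ℕ.≟ 0
    ... | yes ≡0 = ≡0
    ... | no  ≢0 = contradiction (sum≡0⇒ (λ b → newly M (toℕ a) (toℕ a) (toℕ b))
        (sum≡0⇒ (λ a′ → sum {n} (λ b → newly M (toℕ a) (toℕ a′) (toℕ b))) (gain≡0 a) a) b)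
      (⇒and (fresh M (toℕ a) (toℕ b)) ≢0 (⇒and (monitors (toℕ a) (toℕ a) (toℕ b)) {1}
        (monitors-self a b (proj₂ (fresh⇒ M (toℕ a) (toℕ b) ≢0))) λ ()))

  -- After i passes from m uncovered edges the vertices in M are chosen; any
  -- greedy run from here on completes one from the start.
  record Progress (m i : ℕ) (M : ℕ → ℕ) : Set where
    field
      steps    : ℕ
      chosen≤  : chosen M ≤ steps
      continue : ∀ S → Covers S → ∀ {N} → GreedyRun ∣ S ∣ (remaining M) N →
                 GreedyRun ∣ S ∣ m (steps + N)
      -- Every pass covers an edge until none is left, so after `n * n` passes both alternatives say
      -- that nothing remains.
      advance  : i + remaining M ≤ n * n ⊎ remaining M ≡ 0

  open Progress

  -- If even the largest gain is 0, then nothing remains by `no-gain`, and the update adds 0.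
  -- Otherwise the pass is a `choose` step, whose greedy bound comes from `remaining≤`.
  progress-step : ∀ {m i M} (z : Fin n) → (∀ (x : Fin n) → gain M (toℕ x) ≤ gain M (toℕ z)) →
                  Progress m i M → Progress m (suc i) (update (toℕ z) (M (toℕ z) + gain M (toℕ z)) M)
  progress-step {m} {i} {M} z maximal P with gain M (toℕ z) ℕ.≟ 0
  ... | yes g≡0 = record
    { steps    = P .steps
    ; chosen≤  = ℕ.≤-trans (ℕ.≤-reflexive (chosen-cong M″ M same)) (P .chosen≤)
    ; continue = λ S covers g → P .continue S covers (subst (λ u → GreedyRun ∣ S ∣ u _) (remaining-cong M″ M same) g)
    ; advance  = inj₂ (trans (remaining-cong M″ M same)
        (no-gain M λ x → ℕ.n≤0⇒n≡0 (ℕ.≤-trans (maximal x) (ℕ.≤-reflexive g≡0))))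
    }
    where
    M″ = update (toℕ z) (M (toℕ z) + gain M (toℕ z)) M
    same : ∀ x → M″ (toℕ x) ≡ M (toℕ x)
    same x with x ≟ z
    ... | yes refl = trans (update-same M _ (toℕ z)) (trans (cong (M (toℕ z) +_) g≡0) (ℕ.+-identityʳ _))
    ... | no  x≢z  = update-other M _ (λ eq → x≢z (toℕ-injective eq))
  ... | no g≢0 = record
    { steps    = suc (P .steps)
    ; chosen≤  = ℕ.≤-trans (chosen-update M z v≢0) (s≤s (P .chosen≤))
    -- The new choice is put in front of the given run, and the earlier choices in front of both.
    ; continue = λ S covers {N} run → subst (GreedyRun ∣ S ∣ m) (ℕ.+-suc (P .steps) N) (P .continue S covers
        (subst (λ u → GreedyRun ∣ S ∣ u (suc N)) left
          (choose g (ℕ.n≢0⇒n>0 g≢0) (ℕ.≤-trans (ℕ.≤-reflexive left) (remaining≤ M S g covers maximal)) run)))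
    ; advance  = advanced (P .advance)
    }
    where
    g = gain M (toℕ z)
    M′ = update (toℕ z) (M (toℕ z) + g) M
    v≢0 : M (toℕ z) + g ≢ 0
    v≢0 eq = g≢0 (ℕ.m+n≡0⇒n≡0 (M (toℕ z)) eq)
    left : remaining M′ + g ≡ remaining M
    left = remaining-update M z v≢0
    advanced : i + remaining M ≤ n * n ⊎ remaining M ≡ 0 → suc i + remaining M′ ≤ n * n ⊎ remaining M′ ≡ 0
    advanced (inj₂ none) = inj₂ (ℕ.m+n≡0⇒m≡0 (remaining M′) (trans left none))
    advanced (inj₁ i+r≤) = inj₁ (begin
      suc i + remaining M′     ≡⟨ ℕ.+-suc i (remaining M′) ⟨
      i + suc (remaining M′)   ≡⟨ cong (i +_) (ℕ.+-comm 1 (remaining M′)) ⟩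
      i + (remaining M′ + 1)   ≤⟨ ℕ.+-monoʳ-≤ i (ℕ.+-monoʳ-≤ (remaining M′) (ℕ.n≢0⇒n>0 g≢0)) ⟩
      i + (remaining M′ + g)   ≡⟨ cong (i +_) left ⟩
      i + remaining M          ≤⟨ i+r≤ ⟩
      n * n                    ∎)
      where open ℕ.≤-Reasoning

  remaining≤n² : ∀ M → remaining M ≤ n * n
  remaining≤n² M = begin
    remaining M                              ≤⟨ sum-mono {n} (λ a → sum-mono {n} (λ b → fresh≤1 M (toℕ a) (toℕ b))) ⟩
    sum {n} (λ a → sum {n} (λ b → 1))        ≡⟨ (sum-cong-≗ {n} λ a → trans (sum-const n 1) (ℕ.*-identityʳ n)) ⟩
    sum {n} (λ a → n)                        ≡⟨ sum-const n n ⟩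
    n * n                                    ∎
    where open ℕ.≤-Reasoning

  progress-start : ∀ {M} → (∀ (x : Fin n) → M (toℕ x) ≡ 0) → Progress (remaining M) 0 M
  progress-start {M} empty = record
    { steps    = 0
    ; chosen≤  = ℕ.≤-reflexive (⇒sum≡0 {n} _ λ x → cong (λ m → if≢0 m 1 0) (empty x))
    ; continue = λ S covers run → run
    ; advance  = inj₁ (remaining≤n² M)
    }

  progress-end : ∀ {m M} → Progress m (n * n) M →
                 remaining M ≡ 0 × ∃[ N ] chosen M ≤ N × (∀ S → Covers S → GreedyRun ∣ S ∣ m N)
  progress-end {m} {M} P = none , P .steps , P .chosen≤ , λ S covers →
    subst (GreedyRun ∣ S ∣ m) (ℕ.+-identityʳ (P .steps))
      (P .continue S covers (subst (λ u → GreedyRun ∣ S ∣ u 0) (sym none) done))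
    where
    none : remaining M ≡ 0
    none with P .advance
    ... | inj₁ ≤n² = ℕ.n≤0⇒n≡0 (ℕ.+-cancelˡ-≤ (n * n) _ 0 (ℕ.≤-trans ≤n² (ℕ.≤-reflexive (sym (ℕ.+-identityʳ (n * n))))))
    ... | inj₂ ≡0  = ≡0

  nothing-remains : ∀ M → remaining M ≡ 0 → ∀ (a b : Fin n) → toℕ a < toℕ b → edge (toℕ a) (toℕ b) ≢ 0 →
                    ∃[ x ] M (toℕ x) ≢ 0 × monitors (toℕ x) (toℕ a) (toℕ b) ≢ 0
  nothing-remains M none a b a<b e≢0 with covered M (toℕ a) (toℕ b) ℕ.≟ 0
  ... | no  c≢0 with x , ne ← sum≢0⇒ {n} (λ x → if≢0 (M (toℕ x)) (monitors (toℕ x) (toℕ a) (toℕ b)) 0) c≢0 =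
    x , and⇒ (M (toℕ x)) ne
  ... | yes c≡0 = contradiction
    (sum≡0⇒ (λ b → fresh M (toℕ a) (toℕ b)) (sum≡0⇒ (λ a → sum {n} (λ b → fresh M (toℕ a) (toℕ b))) none a) b)
    (⇒and (toℕ b ∸ toℕ a) (ℕ.m>n⇒m∸n≢0 a<b) (⇒and (edge (toℕ a) (toℕ b)) e≢0
      (⇒unless (covered M (toℕ a) (toℕ b)) c≡0 λ ())))

-- Correctness

module Search (n : ℕ) (A : Arrays)
  (self : ∀ (a b : Fin n) → edge n A (toℕ a) (toℕ b) ≢ 0 →
          Numeric.monitors n (edge n A) (toℕ a) (toℕ a) (toℕ b) ≢ 0)
  where

  open Numeric n (edge n A) using (monitors)
  open CoverageProperties n (edge n A) monitors self public

  record Consistent (B : Arrays) : Set where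
    field
      edges≡    : B 0 ≡ A 0
      monitors≡ : ∀ {x a b} → x < n → a < n → b < n → B 3 (position n x a b) ≡ monitors x a b

  open Consistent

  record Scanned (M : ℕ → ℕ) (x : ℕ) (B : Arrays) : Set where
    field
      consistent : Consistent B
      chosen≡    : B 1 ≡ M
      best<n     : B 4 0 < n
      maximal    : ∀ {y} → y < x → gain M y ≤ gain M (B 4 0)

  open Scanned

  compareBest-correct : ∀ {M x B d} {e : Vec ℕ d} → x < n → Scanned M x B →
                        Scanned M (suc x) (exec n (x ∷ e) compareBest B)
  compareBest-correct {M} {x} {B} {e = e} x<n S = record
    { consistent = record { edges≡ = C .edges≡ ; monitors≡ = C .monitors≡ }
    ; chosen≡    = S .chosen≡
    ; best<n     = subst (_< n) (sym new≡) (proj₁ (better _ refl))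
    ; maximal    = λ y<1+x → ℕ.≤-trans (proj₂ (better _ refl) y<1+x) (ℕ.≤-reflexive (cong (gain M) (sym new≡)))
    }
    where
    C = S .consistent
    z = B 4 0
    gain≡ : ∀ i → lookup (z ∷ x ∷ e) i < n →
            eval n B (z ∷ x ∷ e) (gainTerm i) ≡ gain M (lookup (z ∷ x ∷ e) i)
    gain≡ i i<n = trans (eval-gain n A {B} (C .edges≡) (C .monitors≡) (z ∷ x ∷ e) i i<n)
      (cong (λ N → gain N (lookup (z ∷ x ∷ e) i)) (S .chosen≡))
    new≡ : exec n (x ∷ e) compareBest B 4 0 ≡ if≢0 (gain M x ∸ gain M z) x z
    new≡ = if≢0-cong (cong₂ _∸_ (gain≡ (suc zero) x<n) (gain≡ zero (S .best<n))) refl refl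
    better : ∀ d → gain M x ∸ gain M z ≡ d →
             if≢0 d x z < n × (∀ {y} → y < suc x → gain M y ≤ gain M (if≢0 d x z))
    better zero    eq = S .best<n , λ { {y} (s≤s y≤x) → le y (ℕ.m≤n⇒m<n∨m≡n y≤x) }
      where
      le : ∀ y → y < x ⊎ y ≡ x → gain M y ≤ gain M z
      le y (inj₁ y<x)  = S .maximal y<x
      le y (inj₂ refl) = ℕ.m∸n≡0⇒m≤n eq
    better (suc d) eq = x<n , λ { {y} (s≤s y≤x) → le y (ℕ.m≤n⇒m<n∨m≡n y≤x) }
      where
      z≤x : gain M z ≤ gain M x
      z≤x = ℕ.<⇒≤ (ℕ.≰⇒> (λ x≤z → ℕ.1+n≢0 (trans (sym eq) (ℕ.m≤n⇒m∸n≡0 x≤z))))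
      le : ∀ y → y < x ⊎ y ≡ x → gain M y ≤ gain M x
      le y (inj₁ y<x)  = ℕ.≤-trans (S .maximal y<x) z≤x
      le y (inj₂ refl) = ℕ.≤-refl

  record Pass (m i : ℕ) (B : Arrays) : Set where
    field
      consistent : Consistent B
      best<n     : B 4 0 < n
      progress   : Progress m i (B 1)

  takeBest-correct : ∀ {m i B d} {e : Vec ℕ d} → Scanned (B 1) n B → Progress m i (B 1) →
                     Pass m (suc i) (exec n e takeBest B)
  takeBest-correct {m} {i} {B} {e = e} S P = record
    { consistent = record { edges≡ = C .edges≡ ; monitors≡ = C .monitors≡ }
    ; best<n     = S .best<n
    ; progress   = subst (λ v → Progress m (suc i) (update z v (B 1)))
        (cong (B 1 z +_) (sym (eval-gain n A {B} (C .edges≡) (C .monitors≡) (z ∷ e) zero (S .best<n))))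
        (subst (λ w → Progress m (suc i) (update w (B 1 w + gain (B 1) w) (B 1))) z′≡z
          (progress-step (fromℕ< (S .best<n))
            (λ x → ℕ.≤-trans (S .maximal (toℕ<n x)) (ℕ.≤-reflexive (cong (gain (B 1)) (sym z′≡z)))) P))
    }
    where
    C = S .consistent
    z = B 4 0
    z′≡z = toℕ-fromℕ< (S .best<n)

  pass-correct : ∀ {m i B d} {e : Vec ℕ d} → Pass m i B →
                 Pass m (suc i) (exec n e (loop compareBest ﹔ takeBest) B)
  pass-correct {m} {i} {B} {e = e} P =
    takeBest-correct {m} {i} {B′} {e = e} (record
      { consistent = S .consistent ; chosen≡ = refl ; best<n = S .best<n
      ; maximal = λ {y} y<n → subst (λ N → gain N y ≤ gain N (B′ 4 0)) (sym (S .chosen≡)) (S .maximal y<n) })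
      (subst (Progress m i) (sym (S .chosen≡)) (P .Pass.progress))
    where
    B′ = exec n e (loop compareBest) B
    S : Scanned (B 1) n B′
    S = repeat-invariant (Scanned (B 1)) (λ x B x<n s → compareBest-correct {e = e} x<n s) (record
      { consistent = P .Pass.consistent ; chosen≡ = refl ; best<n = P .Pass.best<n ; maximal = λ () })

  -- Pass `j` of round `i` has number n * i + j, so a finished round hands over to the next without
  -- a gap.
  greedy-correct : ∀ {m B} → Pass m 0 B → Pass m (n * n) (exec n [] greedy B)
  greedy-correct {m} {B} P = subst (λ i → Pass m i (exec n [] greedy B)) (ℕ.+-identityʳ (n * n))
    (repeat-invariant (λ i → Pass m (n * i + 0)) (λ i B i<n p →
      subst (λ c → Pass m c (exec n (i ∷ []) (loop (loop compareBest ﹔ takeBest)) B)) (lex-suc n i)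
        (repeat-invariant (λ j → Pass m (n * i + j)) (λ j B j<n p →
          subst (λ c → Pass m c (exec n (j ∷ i ∷ []) (loop compareBest ﹔ takeBest) B)) (sym (ℕ.+-suc (n * i) j))
            (pass-correct {B = B} {e = j ∷ i ∷ []} p)) p))
      (subst (λ i → Pass m i B) (sym (trans (ℕ.+-identityʳ (n * 0)) (ℕ.*-zeroʳ n))) P))

-- Counting edges and reading the input

module _ {A : Set} (p : A → Bool) where

  length-filterᵇ-++ : ∀ xs ys → length (filterᵇ p (xs ++ ys)) ≡ length (filterᵇ p xs) + length (filterᵇ p ys)
  length-filterᵇ-++ []       ys = refl
  length-filterᵇ-++ (x ∷ xs) ys with p x
  ... | true  = cong suc (length-filterᵇ-++ xs ys)
  ... | false = length-filterᵇ-++ xs ys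

  length-filterᵇ-map : ∀ {B : Set} {n} (f : B → A) (g : Fin n → B) →
    length (filterᵇ p (map f (List.tabulate g))) ≡ sum (λ i → indicator (p (f (g i))))
  length-filterᵇ-map {n = zero}  f g = refl
  length-filterᵇ-map {n = suc n} f g with p (f (g zero))
  ... | true  = cong suc (length-filterᵇ-map f (g ∘ suc))
  ... | false = length-filterᵇ-map f (g ∘ suc)

length-filterᵇ-product : ∀ {m n} {A : Set} (p : A × Fin n → Bool) (f : Fin m → A) →
  length (filterᵇ p (cartesianProduct (List.tabulate f) (allFin n))) ≡
  sum (λ i → sum (λ j → indicator (p (f i , j))))
length-filterᵇ-product {zero}  p f = refl
length-filterᵇ-product {suc m} {n} p f =
  trans (length-filterᵇ-++ p (map (f zero ,_) (allFin n)) _)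
    (cong₂ _+_ (length-filterᵇ-map p (f zero ,_) id) (length-filterᵇ-product p (f ∘ suc)))

encodeGraph-edge : ∀ G (u v : Vertex G) →
  edge (order G) (arrs (encodeGraph G)) (toℕ u) (toℕ v) ≡ indicator (adj G u v)
encodeGraph-edge G u v with (order G * toℕ u + toℕ v) ℕ.<? order G * order G
... | yes c<n² = cong (λ p → indicator (uncurry (adj G) p)) (trans
  (cong (remQuot (order G)) (toℕ-injective (trans (toℕ-fromℕ< c<n²) (sym (toℕ-combine u v)))))
  (remQuot-combine u v))
... | no  c≮n² = contradiction
  (subst (_< order G * order G) (toℕ-combine u v) (toℕ<n (combine u v))) c≮n²

indicator≢0⇒ : ∀ {b} → indicator b ≢ 0 → T b
indicator≢0⇒ {true}  _  = _
indicator≢0⇒ {false} ne = contradiction refl ne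

⇒indicator≢0 : ∀ {b} → T b → indicator b ≢ 0
⇒indicator≢0 {true} _ ()

module Correctness (G : Graph) (0<n : 0 < order G) where

  private
    n = order G
    A = arrs (encodeGraph G)

  edge⇒adj : ∀ u v → edge n A (toℕ u) (toℕ v) ≢ 0 → Adj G u v
  edge⇒adj u v ne = indicator≢0⇒ (subst (_≢ 0) (encodeGraph-edge G u v) ne)

  adj⇒edge : ∀ u v → Adj G u v → edge n A (toℕ u) (toℕ v) ≢ 0
  adj⇒edge u v e = subst (_≢ 0) (sym (encodeGraph-edge G u v)) (⇒indicator≢0 e)

  open Reflection G (edge n A) edge⇒adj adj⇒edge
  open Search n A (λ a b ne → monitors-self (edge⇒adj a b ne))

  -- Array 1 is zero at the start, so every edge is uncovered. This identifies the quantity in the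
  -- greedy bound with the number of edges in the factor.
  edge-count : remaining (A 1) ≡ ∣E G ∣
  edge-count = trans (sum-cong-≗ {n} λ a → sum-cong-≗ {n} λ b → pointwise a b)
    (sym (length-filterᵇ-product (λ (u , v) → ⌊ u <? v ⌋ ∧ adj G u v) id))
    where
    pointwise : ∀ a b → fresh (A 1) (toℕ a) (toℕ b) ≡ indicator (⌊ a <? b ⌋ ∧ adj G a b)
    pointwise a b rewrite encodeGraph-edge G a b | ⇒sum≡0 {n} (λ _ → 0) (λ _ → refl) with a <? b
    ... | no  a≮b rewrite ℕ.m≤n⇒m∸n≡0 (ℕ.≮⇒≥ a≮b) = refl
    ... | yes a<b with toℕ b ∸ toℕ a in eq
    ...   | zero  = contradiction eq (ℕ.m>n⇒m∸n≢0 a<b)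
    ...   | suc d with adj G a b
    ...     | true  = refl
    ...     | false = refl

  private
    B = exec n [] (fill 2 nextWalksTerm) A
    C = exec n [] (fill 3 monitorsTerm) B

    B-correct : Unchanged 2 A B × (∀ {k x y} → k < n → x < n → y < n → B 2 (position n k x y) ≡ walks k x y)
    B-correct = fill-correct 2 A walks nextWalksTerm
      (λ B k x y k<n x<n y<n same earlier → eval-nextWalks n A {B} (same {0} λ ()) k<n x<n y<n earlier)

    C-correct : Unchanged 3 B C × (∀ {x a b} → x < n → a < n → b < n → C 3 (position n x a b) ≡ monitors x a b)
    C-correct = fill-correct 3 B monitors monitorsTerm λ D x a b x<n a<n b<n same _ →
      let e = b ∷ a ∷ x ∷ []
          D₀ : D 0 ≡ A 0
          D₀ = trans (same λ ()) (proj₁ B-correct λ ())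
          D₂ : ∀ {k x y} → k < n → x < n → y < n → D 2 (position n k x y) ≡ walks k x y
          D₂ {k} {x} {y} k<n x<n y<n = trans (cong (λ f → f (position n k x y)) (same {2} λ ()))
                                             (proj₂ B-correct k<n x<n y<n)
      in cong₂ _+_ (eval-critical n A {D} D₀ D₂ e (suc (suc zero)) (suc zero) zero x<n a<n b<n)
                   (eval-critical n A {D} D₀ D₂ e (suc (suc zero)) zero (suc zero) x<n b<n a<n)

    C₁ : C 1 ≡ A 1
    C₁ = trans (proj₁ C-correct {1} λ ()) (proj₁ B-correct {1} λ ())

    C₄ : C 4 ≡ A 4
    C₄ = trans (proj₁ C-correct {4} λ ()) (proj₁ B-correct {4} λ ())

  -- The count `N` is fixed before `S`: one and the same sequence of choices is a greedy run
  -- relative to every covering set, in particular to an optimal one unknown to the algorithm.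
  Solved : (ℕ → ℕ) → Set
  Solved M = remaining M ≡ 0 × ∃[ N ] chosen M ≤ N × (∀ S → Covers S → GreedyRun ∣ S ∣ ∣E G ∣ N)

  algorithm-correct : Solved (exec n [] algorithm A 1)
  algorithm-correct = progress-end (Pass.progress (greedy-correct (record
    { consistent = record
        { edges≡ = trans (proj₁ C-correct {0} λ ()) (proj₁ B-correct {0} λ ()) ; monitors≡ = proj₂ C-correct }
    -- Cell 0 of array 4 is still 0, which is a vertex because the order is positive.
    ; best<n   = subst (λ f → f 0 < n) (sym C₄) 0<n
    ; progress = subst₂ (λ m M → Progress m 0 M) edge-count (sym C₁) (progress-start (λ _ → refl))
    })))

  feasible⇒covers : ∀ S → DistanceEdgeMonitoring G S → Covers S
  feasible⇒covers S feasible a b a<b e with x , x∈S , m ← feasible a b (edge⇒adj a b e) =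
    x , x∈S , ⇒monitors {x} (edge⇒adj a b e) m

  decode-member : ∀ s x → arrs s 1 (toℕ x) ≢ 0 → x ∈ decodeSubset n s
  decode-member s x ne = lookup⇒[]= x _ (trans (lookup∘tabulate _ x) (nonzero (arrs s 1 (toℕ x)) ne))
    where
    nonzero : ∀ m → m ≢ 0 → not (m ≡ᵇ 0) ≡ true
    nonzero zero    ne = contradiction refl ne
    nonzero (suc m) ne = refl

  decode-feasible : ∀ s → Solved (arrs s 1) → DistanceEdgeMonitoring G (decodeSubset n s)
  decode-feasible s (none , _) a b e with <-cmp a b
  ... | tri≈ _ a≡b _ = contradiction a≡b (loopless {G} e)
  ... | tri< a<b _ _
    with x , Mx≢0 , m≢0 ← nothing-remains (arrs s 1) none a b a<b (adj⇒edge a b e) =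
    x , decode-member s x Mx≢0 , monitors⇒ e m≢0
  ... | tri> _ _ b<a
    with x , Mx≢0 , m≢0 ← nothing-remains (arrs s 1) none b a b<a (adj⇒edge b a (adj-swap {G} e)) =
    x , decode-member s x Mx≢0 ,
    monitors⇒ e (λ eq → m≢0 (trans (ℕ.+-comm (critical (toℕ x) (toℕ b) (toℕ a)) _) eq))

  decode-size : ∀ s → ∣ decodeSubset n s ∣ ≡ chosen (arrs s 1)
  decode-size s = trans (∣∣≡sum (decodeSubset n s)) (sum-cong-≗ {n} λ x →
    trans (cong indicator (lookup∘tabulate _ x)) (pointwise (arrs s 1 (toℕ x))))
    where
    pointwise : ∀ m → indicator (not (m ≡ᵇ 0)) ≡ if≢0 m 1 0
    pointwise zero    = refl
    pointwise (suc m) = refl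

  decode-ratio : ∀ s → Solved (arrs s 1) → ∀ S → DistanceEdgeMonitoring G S →
                 ∣ decodeSubset n s ∣ ≤ max1 (ln (∣E G ∣ + 1)) · ∣ S ∣
  decode-ratio s (_ , N , chosen≤N , run) S feasible =
    let q , cut , N≤q = greedy-ratio ∣ S ∣ (run S (feasible⇒covers S feasible)) in
    q , subst (λ m → max1 (ln m) q) (ℕ.+-comm 1 ∣E G ∣) cut ,
    ℚ.≤-trans (fromℕ-mono (ℕ.≤-trans (ℕ.≤-reflexive (decode-size s)) chosen≤N)) N≤q

  correct : ∃[ s ] Run (compile algorithm [] 1) (encodeGraph G) (time n algorithm) s × Solved (arrs s 1)
  correct = Executes.end E , Executes.run E ,
            subst (λ B → Solved (B 1)) (sym (Executes.arrs≡ E)) algorithm-correct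
    where
    ready : Ready {0} n A [] [] 1 (encodeGraph G)
    ready = record
      { positive = s≤s z≤n ; order = refl ; arrays = refl ; allocated = λ () ; variables = λ () }
    E = compile-correct algorithm ready

abstract
  solver : Program
  solver = compile algorithm [] 1

  solver-time : ℕ → ℕ
  solver-time n = time n algorithm

  solver-time-bound : ∃[ k ] ∀ n → solver-time n ≤ k * suc (n * n) ^ k + k
  solver-time-bound = polynomial-in-size (time-polynomial algorithm)

  solver-correct : ∀ G → 0 < order G → ∃[ s ] Run solver (encodeGraph G) (solver-time (order G)) s
    × DistanceEdgeMonitoring G (decodeSubset (order G) s)
    × (∀ S → DistanceEdgeMonitoring G S →
       ∣ decodeSubset (order G) s ∣ ≤ max1 (ln (∣E G ∣ + 1)) · ∣ S ∣)
  solver-correct G 0<n =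
    let s , run , solved = Correctness.correct G 0<n in
    s , run , Correctness.decode-feasible G 0<n s solved , Correctness.decode-ratio G 0<n s solved

theorem23 : ApproximableInPolyTime MinDistanceEdgeMonitoringSet
    (λ (G , _) → max1 (ln (∣E G ∣ + 1)))
theorem23 = solver , proj₁ solver-time-bound , λ (G , 0<n , _) →
  let s , run , feasible , ratio = solver-correct G 0<n in
  solver-time (order G) , s , run , proj₂ solver-time-bound (order G) ,
  feasible , λ S (S-feasible , _) → ratio S S-feasible
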